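{- For all integers $k\geq 6$ and $n\geq 2$, $$\operatorname{GM}_{k}(K_{3}:nK_{2})\leq (2n-1)!!.$$
   Context: All graphs are finite, simple and undirected; colorings are edge-colorings. $nK_2$ is a matching with $n$ edges. A $k$-coloring is exact if all $k$ colors are used at least once. A colored graph is rainbow if no two of its edges have the same color, and monochromatic if all its edges have the same color. Copies of a graph are counted as (not necessarily induced) subgraphs. $(2n-1)!!=(2n-1)(2n-3)\cdots 3\cdot 1$. The Gallai-Ramsey number $\operatorname{gr}_k(G:H)$ is the minimum integer $m$ with $\binom{m}{2}\geq k$ such that for every $N\geq m$, every exact $k$-coloring of $K_N$ contains a rainbow copy of $G$ or a monochromatic copy of $H$. The Gallai-Ramsey multiplicity $\operatorname{GM}_k(G:H)$ (also written $\operatorname{GM}_k(G,H)$) is the minimum, over all exact $k$-colorings of $K_{\operatorname{gr}_k(G:H)}$, of the total number of rainbow copies of $G$ and monochromatic copies of $H$. -}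

module Defs where

open import Data.Fin using (Fin; quotient)
import Data.Fin.Properties as Fin
open import Data.Fin.Subset using (Subset; _∈_)
open import Data.List using (List; length)
import Data.List.Membership.Propositional as List
open import Data.List.Relation.Unary.Unique.Propositional using (Unique)
open import Data.Nat using (ℕ; zero; suc; _+_; _*_; _≤_; _≥_)
open import Data.Nat.Combinatorics using (_C_)
open import Data.Product using (Σ; ∃; ∃₂; _×_; _,_)
open import Data.Sum using (_⊎_)
open import Data.Vec using (Vec; lookup)
open import Function.Bundles using (_⇔_)
open import Function.Definitions using (Injective)
open import Relation.Binary.Definitions using (Decidable; Symmetric; Irreflexive)
open import Relation.Binary.PropositionalEquality using (_≡_; _≢_; sym)
open import Relation.Nullary using (¬_; ¬?)
open import Relation.Nullary.Decidable using (_×-dec_)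

record Graph : Set₁ where
  field
    order  : ℕ
    Adj    : Fin order → Fin order → Set
    adj?   : Decidable Adj
    symm   : Symmetric Adj
    irrefl : Irreflexive _≡_ Adj

K : ℕ → Graph
K n = record
  { order  = n
  ; Adj    = _≢_
  ; adj?   = λ i j → ¬? (i Fin.≟ j)
  ; symm   = λ i≢j j≡i → i≢j (sym j≡i)
  ; irrefl = λ i≡j i≢j → i≢j i≡j
  }

-- The vertices 2a and 2a + 1 form the a-th edge; `quotient 2` sends both to a.
_K₂ : ℕ → Graph
n K₂ = record
  { order  = n * 2
  ; Adj    = λ i j → i ≢ j × quotient {n} 2 i ≡ quotient {n} 2 j
  ; adj?   = λ i j → ¬? (i Fin.≟ j) ×-dec (quotient {n} 2 i Fin.≟ quotient {n} 2 j)
  ; symm   = λ (i≢j , q) → (λ j≡i → i≢j (sym j≡i)) , sym q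
  ; irrefl = λ i≡j (i≢j , _) → i≢j i≡j
  }

-- A subgraph of the complete graph on Fin N.  The edge set is an adjacency
-- matrix and the laws are irrelevant, so `_≡_` on this type is equality of
-- vertex sets and edge sets.
record Subgraph (N : ℕ) : Set where
  field
    vertices   : Subset N
    neighbours : Vec (Subset N) N

  Edge : Fin N → Fin N → Set
  Edge i j = j ∈ lookup neighbours i

  field
    .symm     : ∀ i j → Edge i j → Edge j i
    .irrefl   : ∀ i → ¬ Edge i i
    .incident : ∀ i j → Edge i j → i ∈ vertices

open Subgraph public using (vertices; Edge)

IsCopyOf : ∀ {N} → Graph → Subgraph N → Set
IsCopyOf {N} G S = Σ (Fin order → Fin N) λ f →
    Injective _≡_ _≡_ f
  × (∀ i → i ∈ vertices S ⇔ ∃ λ a → f a ≡ i)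
  × (∀ a b → Adj a b ⇔ Edge S (f a) (f b))
  where open Graph G

-- The values `colour i i` carry no meaning; nothing below depends on them.
record Colouring (k N : ℕ) : Set where
  field
    colour : Fin N → Fin N → Fin k
    symm   : ∀ i j → colour i j ≡ colour j i

open Colouring public using (colour)

module _ {k N : ℕ} (c : Colouring k N) where

  Exact : Set
  Exact = ∀ (x : Fin k) → ∃₂ λ i j → i ≢ j × colour c i j ≡ x

  Rainbow : Subgraph N → Set
  Rainbow S = ∀ {i j u v} → Edge S i j → Edge S u v →
    colour c i j ≡ colour c u v → (i ≡ u × j ≡ v) ⊎ (i ≡ v × j ≡ u)

  Monochromatic : Subgraph N → Set
  Monochromatic S = ∀ {i j u v} → Edge S i j → Edge S u v →
    colour c i j ≡ colour c u v

  RainbowCopy : Graph → Subgraph N → Set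
  RainbowCopy G S = IsCopyOf G S × Rainbow S

  MonochromaticCopy : Graph → Subgraph N → Set
  MonochromaticCopy H S = IsCopyOf H S × Monochromatic S

HasCardinality : {A : Set} → (A → Set) → ℕ → Set
HasCardinality {A} P t = Σ (List A) λ xs →
  Unique xs × (∀ x → x List.∈ xs ⇔ P x) × length xs ≡ t

CopyCount : ∀ {k N} → Colouring k N → Graph → Graph → ℕ → Set
CopyCount c G H t = ∃₂ λ r s →
    HasCardinality (RainbowCopy c G) r
  × HasCardinality (MonochromaticCopy c H) s
  × r + s ≡ t

IsMinimum : (ℕ → Set) → ℕ → Set
IsMinimum P m = P m × (∀ m′ → P m′ → m ≤ m′)

IsGallaiRamseyNumber : ℕ → Graph → Graph → ℕ → Set
IsGallaiRamseyNumber k G H = IsMinimum λ m →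
    m C 2 ≥ k
  × (∀ N → N ≥ m → (c : Colouring k N) → Exact c →
       ∃ (RainbowCopy c G) ⊎ ∃ (MonochromaticCopy c H))

-- `GM k G H` is written as a relation because the Gallai-Ramsey number of an
-- arbitrary pair is not given by a total function; both minima are unique.
IsGallaiRamseyMultiplicity : ℕ → Graph → Graph → ℕ → Set
IsGallaiRamseyMultiplicity k G H g = ∃ λ m →
    IsGallaiRamseyNumber k G H m
  × IsMinimum (λ t → Σ (Colouring k m) λ c → Exact c × CopyCount c G H t) g

infix 9 _!!

_!! : ℕ → ℕ
zero !!          = 1
suc zero !!      = 1
suc (suc n) !!   = suc (suc n) * n !!

{-# OPTIONS --safe #-}

-- The Gallai-Ramsey number is m = (k + 1)(n − 1) + 2.  Give 2n vertices level 0 and n − 1 vertices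
-- each of the levels 1, …, k − 1, and colour an edge by the larger level of its endpoints.  No
-- triangle is rainbow, a colour i ≥ 1 meets all its edges in n − 1 vertices, and the copies of n K₂ in
-- colour 0 are the (2n − 1)!! perfect matchings of the 2n lowest vertices.  With 2n − 1 vertices on
-- level 0 there is no copy at all, so the Gallai-Ramsey number is at least m.
--
-- Conversely every k-colouring of K_m contains a monochromatic n K₂, even without the condition on
-- triangles.  If some vertex lies in every maximum matching of some colour, delete it: the matching
-- number of that colour drops.  Otherwise Gallai's exchange argument shows that a colour with
-- matching number a has at most a (2a + 1) edges, which is too few to cover all pairs of vertices.
module Submission where

open import Data.Bool using (Bool; true; false)
import Data.Bool.Properties as Bool
open import Data.Empty using (⊥)
open import Data.Fin as Fin
  using (Fin; zero; suc; _↑ˡ_; _↑ʳ_; combine; remQuot; quotient; remainder; splitAt; opposite)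
open import Data.Fin.Permutation using (permutation)
import Data.Fin.Properties as Fin
open import Data.Fin.Subset using (Subset; _∈_)
open import Data.Fin.Subset.Properties using (⊆-antisym; _∈?_)
open import Data.List as List
  using (List; []; _∷_; length; filter; deduplicate; cartesianProductWith; allFin; concatMap)
import Data.List.Membership.Propositional as List
open import Data.List.Membership.Propositional.Properties
  using (∈-allFin; ∈-cartesianProductWith⁺; ∈-filter⁺; ∈-filter⁻; ∈-deduplicate⁺; ∈-concatMap⁺;
         ∈-lookup; ∈-map⁺; ∈-map⁻)
import Data.List.Properties as List
open import Data.List.Relation.Binary.Permutation.Propositional
  using (_↭_; ↭-refl; ↭-sym; prep; swap; ↭-trans; ↭⇒↭ₛ)
open import Data.List.Relation.Binary.Permutation.Propositional.Properties using (∈-resp-↭)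
open import Data.List.Relation.Binary.Permutation.Setoid.Properties using (Unique-resp-↭)
import Data.List.Relation.Unary.All as All
open import Data.List.Relation.Unary.AllPairs using (_∷_)
open import Data.List.Relation.Unary.Any as Any using (here; there)
open import Data.List.Relation.Unary.Any.Properties using (lookup-index)
open import Data.List.Relation.Unary.Unique.DecPropositional.Properties using (deduplicate-!)
open import Data.List.Relation.Unary.Unique.Propositional using (Unique)
open import Data.List.Relation.Unary.Unique.Propositional.Properties using (allFin⁺; filter⁺)
open import Data.Nat using (ℕ; zero; suc; _+_; _*_; _∸_; _≤_; _<_; _≥_; z≤n; s≤s; _≤?_)
open import Data.Nat.Combinatorics using (_C_; nCk+nC[k+1]≡[n+1]C[k+1]; nC1≡n)
open import Data.Nat.GeneralisedArithmetic using (fold; fold-+)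
open import Data.Nat.Properties
open import Data.Nat.Solver using (module +-*-Solver)
open import Data.Product using (Σ; ∃; ∃₂; _×_; _,_; proj₁; proj₂; uncurry; map₂)
open import Data.Sum using (_⊎_; inj₁; inj₂; [_,_]′)
open import Data.Unit using (⊤; tt)
open import Data.Vec using (Vec; []; _∷_; lookup; tabulate)
open import Data.Vec.Properties
  using (lookup∘tabulate; tabulate∘lookup; tabulate-cong; []=⇒lookup; lookup⇒[]=; ≡-dec)
open import Function using (_∘_; id; const)
open import Function.Bundles using (_⇔_; mk⇔; Equivalence)
open import Function.Definitions using (Injective)
open import Relation.Binary.Definitions using (Decidable; DecidableEquality; Symmetric; tri<; tri≈; tri>)
open import Relation.Binary.PropositionalEquality
open import Relation.Nullary using (¬_; Dec; yes; no; ¬?; contradiction; does)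
open import Relation.Nullary.Decidable
  using (_×-dec_; _⊎-dec_; _→-dec_; map′; recompute; decidable-stable; ¬¬-excluded-middle)
open import Relation.Nullary.Negation using (contradiction-irr)
open import Defs

open import Algebra.Properties.Semiring.Sum +-*-semiring
  using (sum; sum-syntax; ∑-distrib-+; ∑-comm; sum-permute; sum-cong-≗; *-distribˡ-sum; *-distribʳ-sum)
open Equivalence using (to; from)

-- Indicators of decidable propositions and finite sums.

⟦_⟧ : {P : Set} → Dec P → ℕ
⟦ yes _ ⟧ = 1
⟦ no _ ⟧  = 0

⟦⟧-yes : {P : Set} (p? : Dec P) → P → ⟦ p? ⟧ ≡ 1
⟦⟧-yes (yes _) _ = refl
⟦⟧-yes (no ¬p) p = contradiction p ¬p

⟦⟧-no : {P : Set} (p? : Dec P) → ¬ P → ⟦ p? ⟧ ≡ 0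
⟦⟧-no (yes p) ¬p = contradiction p ¬p
⟦⟧-no (no _) _   = refl

⟦⟧-positive : {P : Set} (p? : Dec P) → 0 < ⟦ p? ⟧ → P
⟦⟧-positive (yes p) _ = p

⟦⟧-mono : {P Q : Set} (p? : Dec P) (q? : Dec Q) → (P → Q) → ⟦ p? ⟧ ≤ ⟦ q? ⟧
⟦⟧-mono (no _)  q? _   = z≤n
⟦⟧-mono (yes p) q? p⇒q = ≤-reflexive (sym (⟦⟧-yes q? (p⇒q p)))

⟦⟧-cong : {P Q : Set} (p? : Dec P) (q? : Dec Q) → (P → Q) → (Q → P) → ⟦ p? ⟧ ≡ ⟦ q? ⟧
⟦⟧-cong p? q? p⇒q q⇒p = ≤-antisym (⟦⟧-mono p? q? p⇒q) (⟦⟧-mono q? p? q⇒p)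

sum-mono : ∀ {n} {f g : Fin n → ℕ} → (∀ i → f i ≤ g i) → sum f ≤ sum g
sum-mono {zero}  f≤g = z≤n
sum-mono {suc n} f≤g = +-mono-≤ (f≤g zero) (sum-mono (f≤g ∘ suc))

sum-zero : ∀ {n} {f : Fin n → ℕ} → (∀ i → f i ≡ 0) → sum f ≡ 0
sum-zero {zero}  f≡0 = refl
sum-zero {suc n} f≡0 = cong₂ _+_ (f≡0 zero) (sum-zero (f≡0 ∘ suc))

sum-const : ∀ n c → ∑[ i < n ] c ≡ n * c
sum-const zero    c = refl
sum-const (suc n) c = cong (c +_) (sum-const n c)

term≤sum : ∀ {n} (f : Fin n → ℕ) i → f i ≤ sum f
term≤sum f zero    = m≤m+n _ _
term≤sum f (suc i) = ≤-trans (term≤sum (f ∘ suc) i) (m≤n+m _ _)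

sum-positive : ∀ {n} (f : Fin n → ℕ) → 0 < sum f → ∃ λ i → 0 < f i
sum-positive {suc n} f 0<s with f zero in eq
... | suc _ = zero , subst (0 <_) (sym eq) (s≤s z≤n)
... | zero with sum-positive (f ∘ suc) 0<s
... | i , 0<fi = suc i , 0<fi

sum-subsingleton : ∀ {n} (f : Fin n → ℕ) → (∀ i → f i ≤ 1) →
  (∀ i j → 0 < f i → 0 < f j → i ≡ j) → sum f ≤ 1
sum-subsingleton {zero}  f _ _ = z≤n
sum-subsingleton {suc n} f f≤1 unique with f zero in eq
... | zero = sum-subsingleton (f ∘ suc) (f≤1 ∘ suc)
               λ i j 0<i 0<j → Fin.suc-injective (unique (suc i) (suc j) 0<i 0<j)
... | suc m = ≤-trans (+-mono-≤ (subst (_≤ 1) eq (f≤1 zero))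
                                (≤-reflexive (sum-zero rest≡0))) ≤-refl
  where
  rest≡0 : ∀ i → f (suc i) ≡ 0
  rest≡0 i with f (suc i) in eq′
  ... | zero  = refl
  ... | suc _ with () ← unique zero (suc i) (subst (0 <_) (sym eq) (s≤s z≤n))
                                            (subst (0 <_) (sym eq′) (s≤s z≤n))

δ : ∀ {n} → Fin n → Fin n → ℕ
δ i j = ⟦ i Fin.≟ j ⟧

sum-δ : ∀ {n} (i : Fin n) → ∑[ j < n ] δ i j ≡ 1
sum-δ i = ≤-antisym
  (sum-subsingleton (δ i) (λ j → ⟦⟧-mono (i Fin.≟ j) (yes tt) _)
    λ j l 0<j 0<l → trans (sym (δ-positive j 0<j)) (δ-positive l 0<l))
  (subst (_≤ sum (δ i)) (⟦⟧-yes (i Fin.≟ i) refl) (term≤sum (δ i) i))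
  where
  δ-positive : ∀ j → 0 < δ i j → i ≡ j
  δ-positive j 0<δ with i Fin.≟ j
  ... | yes i≡j = i≡j

-- Turns a count into distinct witnesses; `matching⇒copy` uses it to choose `n` edges of a matching
-- through their smaller endpoints.
injection-of-sum : ∀ {N n} {P : Fin N → Set} (P? : ∀ x → Dec (P x)) →
  n ≤ ∑[ x < N ] ⟦ P? x ⟧ →
  Σ (Fin n → Fin N) λ e → (∀ {a b} → e a ≡ e b → a ≡ b) × (∀ a → P (e a))
injection-of-sum {zero}  {zero} P? n≤ = (λ ()) , (λ { {()} }) , λ ()
injection-of-sum {suc N} {zero} P? n≤ = (λ ()) , (λ { {()} }) , λ ()
injection-of-sum {suc N} {suc n} P? n≤ with P? zero
... | no _ with injection-of-sum (P? ∘ suc) n≤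
... | e , inj , Pe = suc ∘ e , inj ∘ Fin.suc-injective , Pe
injection-of-sum {suc N} {suc n} {P} P? (s≤s n≤) | yes p with injection-of-sum (P? ∘ suc) n≤
... | e , inj , Pe = e′ , inj′ , Pe′
  where
  e′ : Fin (suc n) → Fin (suc N)
  e′ zero    = zero
  e′ (suc a) = suc (e a)
  inj′ : ∀ {a b} → e′ a ≡ e′ b → a ≡ b
  inj′ {zero}  {zero}  _  = refl
  inj′ {suc _} {suc _} eq = cong suc (inj (Fin.suc-injective eq))
  Pe′ : ∀ a → P (e′ a)
  Pe′ zero    = p
  Pe′ (suc a) = Pe a

-- Iterates of a map and odd periods.

infix 8 _^[_]_

_^[_]_ : {A : Set} → (A → A) → ℕ → A → A
h ^[ t ] x = fold x h t

^-+ : {A : Set} (h : A → A) (s t : ℕ) (x : A) → h ^[ s + t ] x ≡ h ^[ s ] (h ^[ t ] x)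
^-+ h s t x = fold-+ x h s {t}

^-* : {A : Set} (h : A → A) (s t : ℕ) {x : A} → h ^[ t ] x ≡ x → h ^[ s * t ] x ≡ x
^-* h zero    t eq = refl
^-* h (suc s) t {x} eq = trans (^-+ h t (s * t) x) (trans (cong (h ^[ t ]_) (^-* h s t eq)) eq)

-- The period of x is odd and divides 2e, hence e.
odd-period : {A : Set} (h : A → A) (a e : ℕ) {x : A} →
  h ^[ suc (a + a) ] x ≡ x → h ^[ suc ((a + e) + (a + e)) ] x ≡ x →
  h ^[ a + e ] x ≡ h ^[ a ] x
odd-period h a e {x} pa pb = trans (^-+ h a e x) (cong (h ^[ a ]_) pe)
  where
  open +-*-Solver
  p2e : h ^[ e + e ] x ≡ x
  p2e = trans (cong (h ^[ e + e ]_) (sym pa)) (trans (sym (^-+ h (e + e) (suc (a + a)) x))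
        (trans (cong (h ^[_] x)
          (solve 2 (λ a e → (e :+ e) :+ (con 1 :+ (a :+ a)) := con 1 :+ ((a :+ e) :+ (a :+ e))) refl a e)) pb))
  pe : h ^[ e ] x ≡ x
  pe = trans (cong (h ^[ e ]_) (sym (^-* h a (e + e) p2e))) (trans (sym (^-+ h e (a * (e + e)) x))
       (trans (cong (h ^[_] x) (solve 2 (λ a e → e :+ a :* (e :+ e) := e :* (con 1 :+ (a :+ a))) refl a e))
         (^-* h e (suc (a + a)) pa)))

-- Matchings, encoded as involutions whose fixed points are the uncovered vertices.

record IsMatching {N : ℕ} (E : Fin N → Fin N → Set) (f : Fin N → Fin N) : Set where
  field
    involutive : ∀ x → f (f x) ≡ x
    edge       : ∀ x → f x ≢ x → E x (f x)

open IsMatching public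

-- An edge is counted once, at its smaller endpoint, so that `size` is the number of edges.
ascent : ∀ {N} → (Fin N → Fin N) → Fin N → ℕ
ascent f x = ⟦ x Fin.<? f x ⟧

size : ∀ {N} → (Fin N → Fin N) → ℕ
size f = sum (ascent f)

insert : ∀ {N} → (Fin N → Fin N) → Fin N → Fin N → Fin N → Fin N
insert f u v x with x Fin.≟ u | x Fin.≟ v
... | yes _ | _     = v
... | no _  | yes _ = u
... | no _  | no _  = f x

insert-left : ∀ {N} (f : Fin N → Fin N) u v → insert f u v u ≡ v
insert-left f u v with u Fin.≟ u
... | yes _  = refl
... | no u≢u = contradiction refl u≢u

insert-right : ∀ {N} (f : Fin N → Fin N) {u v} → u ≢ v → insert f u v v ≡ u
insert-right f {u} {v} u≢v with v Fin.≟ u | v Fin.≟ v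
... | yes v≡u | _      = contradiction (sym v≡u) u≢v
... | no _    | yes _  = refl
... | no _    | no v≢v = contradiction refl v≢v

insert-other : ∀ {N} (f : Fin N → Fin N) {u v x} → x ≢ u → x ≢ v → insert f u v x ≡ f x
insert-other f {u} {v} {x} x≢u x≢v with x Fin.≟ u | x Fin.≟ v
... | yes x≡u | _       = contradiction x≡u x≢u
... | no _    | yes x≡v = contradiction x≡v x≢v
... | no _    | no _    = refl

id-matching : ∀ {N} {E : Fin N → Fin N → Set} → IsMatching E id
id-matching = record { involutive = λ _ → refl ; edge = λ x x≢x → contradiction refl x≢x }

-- Membership in an alternating path quantifies over unbounded exponents. Its decidability is used
-- only under a double negation, which suffices because the goals reached from it are decidable or
-- negative.
¬¬-decidable : ∀ {n} (P : Fin n → Set) → ¬ ¬ (∀ x → Dec (P x))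
¬¬-decidable {zero}  P k = k λ ()
¬¬-decidable {suc n} P k = ¬¬-excluded-middle λ p₀ → ¬¬-decidable (P ∘ suc) λ ps →
  k λ { zero → p₀ ; (suc x) → ps x }

-- Maximum matchings: augmentation and Gallai's exchange argument.

module Matchings {N : ℕ} (E : Fin N → Fin N → Set) (E? : Decidable E)
                 (E-sym : Symmetric E) (E-irrefl : ∀ {x} → ¬ E x x) where

  moved : (Fin N → Fin N) → Fin N → ℕ
  moved f x = ⟦ ¬? (f x Fin.≟ x) ⟧

  -- The involution swaps the smaller and the larger endpoints of edges, so there are equally many
  -- of both.
  sum-moved : ∀ {f} → IsMatching E f → sum (moved f) ≡ size f + size f
  sum-moved {f} mf = begin
    sum (moved f)                           ≡⟨ sum-cong-≗ split ⟩
    ∑[ x < N ] (ascent f x + down x)        ≡⟨ ∑-distrib-+ (ascent f) down ⟩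
    size f + sum down
      ≡⟨ cong (size f +_) (sum-permute down (permutation f f (involutive mf) (involutive mf))) ⟩
    size f + sum (down ∘ f)
      ≡⟨ cong (size f +_) (sum-cong-≗ λ x → cong (λ y → ⟦ y Fin.<? f x ⟧) (involutive mf x)) ⟩
    size f + size f                         ∎
    where
    open ≡-Reasoning
    down : Fin N → ℕ
    down x = ⟦ f x Fin.<? x ⟧
    split : ∀ x → moved f x ≡ ascent f x + down x
    split x with Fin.<-cmp x (f x)
    ... | tri< x<fx x≢fx fx≮x = trans (⟦⟧-yes (¬? (f x Fin.≟ x)) (x≢fx ∘ sym))
                                      (sym (cong₂ _+_ (⟦⟧-yes (x Fin.<? f x) x<fx) (⟦⟧-no (f x Fin.<? x) fx≮x)))
    ... | tri≈ x≮fx x≡fx fx≮x = trans (⟦⟧-no (¬? (f x Fin.≟ x)) (λ ¬e → ¬e (sym x≡fx)))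
                                      (sym (cong₂ _+_ (⟦⟧-no (x Fin.<? f x) x≮fx) (⟦⟧-no (f x Fin.<? x) fx≮x)))
    ... | tri> x≮fx x≢fx fx<x = trans (⟦⟧-yes (¬? (f x Fin.≟ x)) (x≢fx ∘ sym))
                                      (sym (cong₂ _+_ (⟦⟧-no (x Fin.<? f x) x≮fx) (⟦⟧-yes (f x Fin.<? x) fx<x)))

  -- Joining two uncovered vertices creates an ascent at `u` and keeps every old one, since no
  -- covered vertex is touched.
  augment-< : ∀ {f u v} → IsMatching E f → f u ≡ u → f v ≡ v → E u v → u Fin.< v →
    ∃ λ f′ → IsMatching E f′ × size f < size f′
  augment-< {f} {u} {v} mf fu fv uv u<v = f′ , record { involutive = inv ; edge = edg } , larger
    where
    f′ : Fin N → Fin N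
    f′ = insert f u v
    u≢v : u ≢ v
    u≢v = Fin.<⇒≢ u<v
    at-u : f′ u ≡ v
    at-u = insert-left f u v
    at-v : f′ v ≡ u
    at-v = insert-right f u≢v
    inv : ∀ x → f′ (f′ x) ≡ x
    inv x with x Fin.≟ u | x Fin.≟ v
    ... | yes refl | _        = at-v
    ... | no _     | yes refl = at-u
    ... | no x≢u   | no x≢v   = trans (insert-other f (λ e → x≢u (back e fu)) (λ e → x≢v (back e fv)))
                                        (involutive mf x)
      where
      back : ∀ {y} → f x ≡ y → f y ≡ y → x ≡ y
      back e fy = trans (sym (involutive mf x)) (trans (cong f e) fy)
    edg : ∀ x → f′ x ≢ x → E x (f′ x)
    edg x moves with x Fin.≟ u | x Fin.≟ v
    ... | yes refl | _        = uv
    ... | no _     | yes refl = E-sym uv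
    ... | no _     | no _     = edge mf x moves
    pointwise : ∀ x → ascent f x + δ u x ≤ ascent f′ x
    pointwise x with u Fin.≟ x
    ... | yes refl = ≤-reflexive (trans (cong (_+ 1) (⟦⟧-no (u Fin.<? f u) (λ u<fu → Fin.<⇒≢ u<fu (sym fu))))
                                        (sym (⟦⟧-yes (u Fin.<? f′ u) (subst (u Fin.<_) (sym at-u) u<v))))
    ... | no u≢x = subst (_≤ ascent f′ x) (sym (+-identityʳ _)) (⟦⟧-mono (x Fin.<? f x) (x Fin.<? f′ x) up)
      where
      up : x Fin.< f x → x Fin.< f′ x
      up x<fx = subst (x Fin.<_) (sym (insert-other f (u≢x ∘ sym) λ { refl → Fin.<⇒≢ x<fx (sym fv) })) x<fx
    larger : size f < size f′
    larger = begin
      suc (size f)           ≡⟨ +-comm 1 (size f) ⟩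
      size f + 1             ≡⟨ cong (size f +_) (sym (sum-δ u)) ⟩
      size f + sum (δ u)     ≡⟨ sym (∑-distrib-+ (ascent f) (δ u)) ⟩
      ∑[ x < N ] (ascent f x + δ u x)  ≤⟨ sum-mono pointwise ⟩
      size f′                ∎
      where open ≤-Reasoning

  augment : ∀ {f u v} → IsMatching E f → f u ≡ u → f v ≡ v → E u v →
    ∃ λ f′ → IsMatching E f′ × size f < size f′
  augment {f} {u} {v} mf fu fv uv with Fin.<-cmp u v
  ... | tri< u<v _ _  = augment-< mf fu fv uv u<v
  ... | tri≈ _ refl _ = contradiction uv E-irrefl
  ... | tri> _ _ v<u  = augment-< mf fv fu (E-sym uv) v<u

  module Swap {P : Fin N → Set} (P? : ∀ x → Dec (P x)) where

    mix : (f g : Fin N → Fin N) → Fin N → Fin N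
    mix f g x with P? x
    ... | yes _ = g x
    ... | no _  = f x

    mix-in : ∀ f g {x} → P x → mix f g x ≡ g x
    mix-in f g {x} p with P? x
    ... | yes _ = refl
    ... | no ¬p = contradiction p ¬p

    mix-out : ∀ f g {x} → ¬ P x → mix f g x ≡ f x
    mix-out f g {x} ¬p with P? x
    ... | yes p = contradiction p ¬p
    ... | no _  = refl

    -- Closure of `P` under both involutions ensures that no edge of either matching crosses its
    -- boundary.
    mix-matching : ∀ {f g} → IsMatching E f → IsMatching E g →
      (∀ {x} → P x → P (f x)) → (∀ {x} → P x → P (g x)) → IsMatching E (mix f g)
    mix-matching {f} {g} mf mg Pf Pg = record { involutive = inv ; edge = edg }
      where
      inv : ∀ x → mix f g (mix f g x) ≡ x
      inv x with P? x
      ... | yes p = trans (mix-in f g (Pg p)) (involutive mg x)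
      ... | no ¬p = trans (mix-out f g (λ p → ¬p (subst P (involutive mf x) (Pf p)))) (involutive mf x)
      edg : ∀ x → mix f g x ≢ x → E x (mix f g x)
      edg x moves with P? x
      ... | yes _ = edge mg x moves
      ... | no _  = edge mf x moves

    size-mix : ∀ f g → size (mix f g) + size (mix g f) ≡ size f + size g
    size-mix f g = begin
      size (mix f g) + size (mix g f)  ≡⟨ sym (∑-distrib-+ (ascent (mix f g)) (ascent (mix g f))) ⟩
      ∑[ x < N ] (ascent (mix f g) x + ascent (mix g f) x)  ≡⟨ sum-cong-≗ pointwise ⟩
      ∑[ x < N ] (ascent f x + ascent g x)              ≡⟨ ∑-distrib-+ (ascent f) (ascent g) ⟩
      size f + size g  ∎
      where
      open ≡-Reasoning
      pointwise : ∀ x → ascent (mix f g) x + ascent (mix g f) x ≡ ascent f x + ascent g x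
      pointwise x with P? x
      ... | yes _ = +-comm (ascent g x) (ascent f x)
      ... | no _  = refl

  module Orbit {f g : Fin N → Fin N} (mf : IsMatching E f) (mg : IsMatching E g)
               {u : Fin N} (gu : g u ≡ u) where

    -- Mutually inverse maps. Since `g` fixes `u`, their iterates at `u` trace the path of
    -- alternating `f`- and `g`-edges that starts at `u`.
    σ τ : Fin N → Fin N
    σ = g ∘ f
    τ = f ∘ g

    f-σ : ∀ t → f (σ ^[ t ] u) ≡ τ ^[ suc t ] u
    f-σ zero    = cong f (sym gu)
    f-σ (suc t) = cong (f ∘ g) (f-σ t)

    g-σ : ∀ t → g (σ ^[ t ] u) ≡ τ ^[ t ] u
    g-σ zero    = gu
    g-σ (suc t) = trans (involutive mg _) (f-σ t)

    f-τ : ∀ t → f (τ ^[ suc t ] u) ≡ σ ^[ t ] u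
    f-τ t = trans (cong f (sym (f-σ t))) (involutive mf _)

    g-τ : ∀ t → g (τ ^[ t ] u) ≡ σ ^[ t ] u
    g-τ t = trans (cong g (sym (g-σ t))) (involutive mg _)

    InOrbit : Fin N → Set
    InOrbit x = ∃ λ t → σ ^[ t ] u ≡ x ⊎ τ ^[ t ] u ≡ x

    origin : InOrbit u
    origin = 0 , inj₁ refl

    f-closed : ∀ {x} → InOrbit x → InOrbit (f x)
    f-closed (t     , inj₁ refl) = suc t , inj₂ (sym (f-σ t))
    f-closed (zero  , inj₂ refl) = 1 , inj₂ (sym (f-σ 0))
    f-closed (suc t , inj₂ refl) = t , inj₁ (sym (f-τ t))

    g-closed : ∀ {x} → InOrbit x → InOrbit (g x)
    g-closed (t , inj₁ refl) = t , inj₂ (sym (g-σ t))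
    g-closed (t , inj₂ refl) = t , inj₁ (sym (g-τ t))

    σ-τ : ∀ t → σ ^[ t ] (τ ^[ t ] u) ≡ u
    σ-τ zero    = refl
    σ-τ (suc t) = trans (shift t)
      (trans (cong (λ y → σ ^[ t ] y) (trans (cong g (involutive mf _)) (involutive mg _))) (σ-τ t))
      where
      shift : ∀ s {y} → σ ^[ suc s ] y ≡ σ ^[ s ] (σ y)
      shift zero    = refl
      shift (suc s) = cong σ (shift s)

    -- If `f` fixes the point, then `σ ^[ t ] u` equals `τ ^[ suc t ] u`; as `σ` inverts `τ`,
    -- applying `σ` another t + 1 times leads back to `u`.
    period : ∀ t → f (σ ^[ t ] u) ≡ σ ^[ t ] u → σ ^[ suc (t + t) ] u ≡ u
    period t eq = trans (^-+ σ (suc t) t u)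
      (trans (cong (σ ^[ suc t ]_) (trans (sym eq) (f-σ t))) (σ-τ (suc t)))

    -- A fixed point reached as `τ ^[ suc t ] u` equals its image under `f`, which is `σ ^[ t ] u`,
    -- so `period` covers both directions.
    f-fixed : ∀ {x} → f x ≡ x → InOrbit x → ∃ λ t → σ ^[ t ] u ≡ x × σ ^[ suc (t + t) ] u ≡ u
    f-fixed fx (t     , inj₁ refl) = t , refl , period t fx
    f-fixed fx (zero  , inj₂ refl) = 0 , refl , period 0 fx
    f-fixed fx (suc t , inj₂ refl) = t , τ≡σ , period t (trans (cong f τ≡σ) (trans fx (sym τ≡σ)))
      where τ≡σ = trans (sym (f-τ t)) fx

    ordered : ∀ {a b} → a ≤ b → σ ^[ suc (a + a) ] u ≡ u → σ ^[ suc (b + b) ] u ≡ u →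
      σ ^[ b ] u ≡ σ ^[ a ] u
    ordered {a} {b} a≤b pa pb with b ∸ a | m+[n∸m]≡n a≤b
    ... | e | refl = odd-period σ a e pa pb

    -- Two vertices of the path left uncovered by `f` give odd periods 2a + 1 and 2b + 1 of `u`, and
    -- `odd-period` then identifies the vertices.
    unique-f-fixed : ∀ {v w} → f v ≡ v → f w ≡ w → InOrbit v → InOrbit w → v ≡ w
    unique-f-fixed fv fw ov ow with f-fixed fv ov | f-fixed fw ow
    ... | a , refl , pa | b , refl , pb with ≤-total a b
    ... | inj₁ a≤b = sym (ordered a≤b pa pb)
    ... | inj₂ b≤a = ordered b≤a pb pa

  -- At most one of `v` and `w` lies on the alternating path from `u`. Replacing `f` by `g` along
  -- this path uncovers `u` and leaves the other one uncovered.
  exchange : ∀ {f g a u v w} → IsMatching E f → IsMatching E g → size f ≡ a → size g ≡ a →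
    (∀ h → IsMatching E h → size h ≤ a) →
    g u ≡ u → f v ≡ v → f w ≡ w → v ≢ w →
    ¬ ¬ ∃ λ h → IsMatching E h × size h ≡ a × h u ≡ u × (h v ≡ v ⊎ h w ≡ w)
  exchange {f} {g} {a} {u} {v} {w} mf mg sf sg maximum gu fv fw v≢w k = ¬¬-decidable InOrbit impossible
    where
    open Orbit mf mg gu
    impossible : ¬ (∀ x → Dec (InOrbit x))
    impossible P? = cases (P? v) (P? w)
      where
      open Swap P?
      h : Fin N → Fin N
      h = mix f g
      mh : IsMatching E h
      mh = mix-matching mf mg f-closed g-closed
      -- The two mixtures have total size 2a and neither exceeds a, so `h` has size exactly a.
      sh : size h ≡ a
      sh = ≤-antisym (maximum h mh) (+-cancelʳ-≤ a a (size h)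
             (≤-trans (≤-reflexive (sym (trans (size-mix f g) (cong₂ _+_ sf sg))))
                      (+-monoʳ-≤ (size h) (maximum (mix g f) (mix-matching mg mf g-closed f-closed)))))
      result : ¬ (h v ≡ v ⊎ h w ≡ w)
      result fixed = k (h , mh , sh , trans (mix-in f g origin) gu , fixed)
      cases : Dec (InOrbit v) → Dec (InOrbit w) → ⊥
      cases (no ¬ov) _        = result (inj₁ (trans (mix-out f g ¬ov) fv))
      cases (yes _)  (no ¬ow) = result (inj₂ (trans (mix-out f g ¬ow) fw))
      cases (yes ov) (yes ow) = v≢w (unique-f-fixed fv fw ov ow)

  -- No two fixed vertices of f are adjacent, and by exchange a moved vertex has at most one fixed
  -- neighbour: 2a (2a − 1) + 2 · 2a ordered pairs in all.
  edge-bound : ∀ {a f} → IsMatching E f → size f ≡ a → (∀ h → IsMatching E h → size h ≤ a) →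
    (∀ u → ∃ (E u) → ¬ ¬ ∃ λ g → IsMatching E g × size g ≡ a × g u ≡ u) →
    ∑[ x < N ] ∑[ y < N ] ⟦ E? x y ⟧ ≤ (a + a) * (a + a) + (a + a)
  -- The 2a diagonal pairs of covered vertices are added on the left, so that all (2a)² pairs of
  -- covered vertices can be charged without subtraction.
  edge-bound {a} {f} mf sf maximum spare = +-cancelʳ-≤ (a + a) _ _ (begin
    ∑[ x < N ] ∑[ y < N ] e x y + (a + a)
      ≡⟨ cong (∑[ x < N ] ∑[ y < N ] e x y +_) (sym diagonal) ⟩
    ∑[ x < N ] ∑[ y < N ] e x y + ∑[ x < N ] ∑[ y < N ] (δ x y * moved f x)
      ≡⟨ sym (∑∑-distrib-+ e λ x y → δ x y * moved f x) ⟩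
    ∑[ x < N ] ∑[ y < N ] (e x y + δ x y * moved f x)
      ≤⟨ sum-mono (λ x → sum-mono (pointwise x)) ⟩
    ∑[ x < N ] ∑[ y < N ] (moved f x * moved f y + (cross x y + cross y x))
      ≡⟨ ∑∑-distrib-+ _ (λ x y → cross x y + cross y x) ⟩
    ∑[ x < N ] ∑[ y < N ] (moved f x * moved f y) + ∑[ x < N ] ∑[ y < N ] (cross x y + cross y x)
      ≡⟨ cong₂ _+_ square (trans (∑∑-distrib-+ cross (λ x y → cross y x))
                               (cong (∑[ x < N ] sum (cross x) +_) (∑-comm (λ x y → cross y x)))) ⟩
    (a + a) * (a + a) + (∑[ x < N ] sum (cross x) + ∑[ x < N ] sum (cross x))
      ≤⟨ +-monoʳ-≤ ((a + a) * (a + a)) (+-mono-≤ cross-bound cross-bound) ⟩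
    (a + a) * (a + a) + ((a + a) + (a + a))
      ≡⟨ sym (+-assoc ((a + a) * (a + a)) (a + a) (a + a)) ⟩
    (a + a) * (a + a) + (a + a) + (a + a)                                   ∎)
    where
    open ≤-Reasoning
    e cross : Fin N → Fin N → ℕ
    e x y = ⟦ E? x y ⟧
    cross? : ∀ x y → Dec (f x ≢ x × f y ≡ y × E x y)
    cross? x y = ¬? (f x Fin.≟ x) ×-dec (f y Fin.≟ y) ×-dec E? x y
    cross x y = ⟦ cross? x y ⟧

    ∑∑-distrib-+ : (s t : Fin N → Fin N → ℕ) →
      ∑[ x < N ] ∑[ y < N ] (s x y + t x y) ≡ ∑[ x < N ] sum (s x) + ∑[ x < N ] sum (t x)
    ∑∑-distrib-+ s t = trans (sum-cong-≗ λ x → ∑-distrib-+ (s x) (t x))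
                             (∑-distrib-+ (λ x → sum (s x)) (λ x → sum (t x)))

    sum-moved-f : sum (moved f) ≡ a + a
    sum-moved-f = trans (sum-moved mf) (cong₂ _+_ sf sf)

    diagonal : ∑[ x < N ] ∑[ y < N ] (δ x y * moved f x) ≡ a + a
    diagonal = trans (sum-cong-≗ λ x → trans (sym (*-distribʳ-sum (moved f x) (δ x)))
                                             (trans (cong (_* moved f x) (sum-δ x)) (*-identityˡ (moved f x))))
                     sum-moved-f

    square : ∑[ x < N ] ∑[ y < N ] (moved f x * moved f y) ≡ (a + a) * (a + a)
    square = trans (sum-cong-≗ λ x → sym (*-distribˡ-sum (moved f x) (moved f)))
      (trans (sym (*-distribʳ-sum (sum (moved f)) (moved f))) (cong₂ _*_ sum-moved-f sum-moved-f))

    unextendable : ∀ {h} → IsMatching E h → size h ≡ a → ∀ {x y} → h x ≡ x → h y ≡ y → ¬ E x y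
    unextendable mh sh hx hy xy with h′ , mh′ , bigger ← augment mh hx hy xy =
      <⇒≱ bigger (≤-trans (maximum h′ mh′) (≤-reflexive (sym sh)))

    pointwise : ∀ x y → e x y + δ x y * moved f x ≤ moved f x * moved f y + (cross x y + cross y x)
    pointwise x y with x Fin.≟ y
    ... | yes refl rewrite ⟦⟧-no (E? x x) E-irrefl with f x Fin.≟ x
    ...   | yes _ = z≤n
    ...   | no _  = m≤m+n 1 _
    pointwise x y | no x≢y with E? x y
    ...   | no _ = z≤n
    ...   | yes xy with f x Fin.≟ x | f y Fin.≟ y
    ...     | yes fx | yes fy = contradiction xy (unextendable mf sf fx fy)
    ...     | no fx  | no fy  = m≤m+n 1 _
    ...     | no fx  | yes fy = m≤m+n 1 _
    ...     | yes fx | no fy  =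
              ≤-reflexive (sym (⟦⟧-yes (¬? (no fy) ×-dec yes fx ×-dec E? y x) (fy , fx , E-sym xy)))

    -- Some maximum matching misses `x`. If `y` and `z` differed, `exchange` would give one that
    -- also misses `y` or `z`, and the edge from `x` to that vertex would augment it.
    one-fixed-neighbour : ∀ {x y z} → f y ≡ y → E x y → f z ≡ z → E x z → y ≡ z
    one-fixed-neighbour {x} {y} {z} fy xy fz xz = decidable-stable (y Fin.≟ z) λ y≢z →
      spare x (y , xy) λ (g , mg , sg , gx) →
      exchange mf mg sf sg maximum gx fy fz y≢z λ
        { (h , mh , sh , hx , inj₁ hy) → unextendable mh sh hx hy xy
        ; (h , mh , sh , hx , inj₂ hz) → unextendable mh sh hx hz xz }

    row-bound : ∀ x → sum (cross x) ≤ moved f x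
    row-bound x with f x Fin.≟ x in eq
    ... | yes fx = ≤-reflexive (sum-zero λ y →
                     ⟦⟧-no (¬? (yes fx) ×-dec (f y Fin.≟ y) ×-dec E? x y) λ (¬e , _) → ¬e fx)
    ... | no fx  = sum-subsingleton _
                     (λ y → ⟦⟧-mono (¬? (no fx) ×-dec (f y Fin.≟ y) ×-dec E? x y) (yes tt) _)
                     λ y z y-counts z-counts →
                       let _ , fy , xy = ⟦⟧-positive (¬? (no fx) ×-dec (f y Fin.≟ y) ×-dec E? x y) y-counts
                           _ , fz , xz = ⟦⟧-positive (¬? (no fx) ×-dec (f z Fin.≟ z) ×-dec E? x z) z-counts
                       in one-fixed-neighbour fy xy fz xz

    cross-bound : ∑[ x < N ] sum (cross x) ≤ a + a
    cross-bound = ≤-trans (sum-mono row-bound) (≤-reflexive sum-moved-f)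

-- The Cockayne-Lorimer bound on the order of a colouring with small monochromatic matchings.

4mn≤[m+n]² : ∀ m n → 4 * (m * n) ≤ (m + n) * (m + n)
4mn≤[m+n]² m n = [ ordered , flipped ]′ (≤-total m n)
  where
  open +-*-Solver
  ordered : ∀ {m n} → m ≤ n → 4 * (m * n) ≤ (m + n) * (m + n)
  ordered {m} m≤n with d , refl ← m≤n⇒∃[o]m+o≡n m≤n =
    ≤-trans (m≤m+n _ (d * d))
            (≤-reflexive (solve 2 (λ m d → con 4 :* (m :* (m :+ d)) :+ d :* d
                                        := (m :+ (m :+ d)) :* (m :+ (m :+ d))) refl m d))
  flipped : n ≤ m → 4 * (m * n) ≤ (m + n) * (m + n)
  flipped n≤m = subst₂ _≤_ (cong (4 *_) (*-comm n m)) (cong₂ _*_ (+-comm n m) (+-comm n m)) (ordered n≤m)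

-- The final contradiction in numbers: `q * suc q` counts the ordered pairs among `suc q` vertices,
-- and `s * (4 * b + 2)` bounds those covered by the colours when the matching bounds sum to `s`.
few-pairs : ∀ b s q → b + s < q → s * (4 * b + 2) < q * suc q
few-pairs b s q b+s<q = begin-strict
  s * (4 * b + 2)
    ≡⟨ solve 2 (λ b s → s :* (con 4 :* b :+ con 2) := con 4 :* (b :* s) :+ con 2 :* s) refl b s ⟩
  4 * (b * s) + 2 * s          ≤⟨ +-monoˡ-≤ (2 * s) (4mn≤[m+n]² b s) ⟩
  -- The added term is the exact gap to (b + s + 1)(b + s + 2).
  (b + s) * (b + s) + 2 * s    <⟨ m<m+n _ {suc (3 * b + s + 1)} (s≤s z≤n) ⟩
  (b + s) * (b + s) + 2 * s + suc (3 * b + s + 1)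
    ≡⟨ solve 2 (λ b s → (b :+ s) :* (b :+ s) :+ con 2 :* s :+ (con 1 :+ (con 3 :* b :+ s :+ con 1))
                         := (con 1 :+ (b :+ s)) :* (con 2 :+ (b :+ s))) refl b s ⟩
  suc (b + s) * suc (suc (b + s))  ≤⟨ *-mono-≤ b+s<q (s≤s b+s<q) ⟩
  q * suc q                    ∎
  where
  open ≤-Reasoning
  open +-*-Solver

module Stripes {N k : ℕ} (c : Fin N → Fin N → Fin k) (c-sym : ∀ x y → c x y ≡ c y x) where

  Within : (Fin N → Set) → Fin k → Fin N → Fin N → Set
  Within A i x y = x ≢ y × A x × A y × c x y ≡ i

  Within-sym : ∀ {A i} → Symmetric (Within A i)
  Within-sym {x = x} {y} (x≢y , ax , ay , cxy) = x≢y ∘ sym , ay , ax , trans (c-sym y x) cxy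

  Within-irrefl : ∀ {A i x} → ¬ Within A i x x
  Within-irrefl (x≢x , _) = x≢x refl

  within? : ∀ {A} → (∀ x → Dec (A x)) → ∀ i → Decidable (Within A i)
  within? A? i x y = ¬? (x Fin.≟ y) ×-dec A? x ×-dec A? y ×-dec (c x y Fin.≟ i)

  -- Cockayne–Lorimer for stripes.  A vertex that is essential in colour i is deleted together with
  -- one unit of a i; once no vertex is essential, counting pairs of vertices gives the bound.
  order-bound : ∀ b p {A : Fin N → Set} (A? : ∀ x → Dec (A x)) (a : Fin k → ℕ) →
    ∑[ x < N ] ⟦ A? x ⟧ ≡ p → (∀ i → a i ≤ b) →
    (∀ i f → IsMatching (Within A i) f → size f ≤ a i) → p ≤ suc (b + sum a)
  order-bound b zero    A? a order a≤b bounded = z≤n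
  order-bound b (suc q) {A} A? a order a≤b bounded =
    -- The inequality is decidable, so the doubly negated matchings below may be used to refute its
    -- negation.
    decidable-stable (suc q ≤? suc (b + sum a)) λ too-small → absurd (≤-pred (≰⇒> too-small))
    where
    module _ (b+s<q : b + sum a < q) where

      α : Fin N → ℕ
      α x = ⟦ A? x ⟧

      -- If no matching of size `a i` missed `v`, deleting `v` and lowering `a i` by one would
      -- preserve the hypotheses, and induction would give q ≤ b + `sum a`.
      spare : ∀ v → A v → ∀ i → ¬ ¬ ∃ λ g → IsMatching (Within A i) g × size g ≡ a i × g v ≡ v
      spare v av i none with a i in eq
      -- For `a i` equal to 0 the empty matching misses `v`.
      ... | zero = none (id , id-matching , n≤0⇒n≡0 (subst (size {N} id ≤_) eq (bounded i id id-matching)) , refl)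
      ... | suc d = <⇒≱ b+s<q (≤-trans
                      (order-bound b q A′? a′ order′ (λ j → ≤-trans (m∸n≤m (a j) (δ i j)) (a≤b j)) bounded′)
                      (≤-reflexive (trans (sym (+-suc b (sum a′))) (cong (b +_) sum-a′))))
        where
        A′ : Fin N → Set
        A′ x = A x × v ≢ x
        A′? : ∀ x → Dec (A′ x)
        A′? x = A? x ×-dec ¬? (v Fin.≟ x)
        a′ : Fin k → ℕ
        a′ j = a j ∸ δ i j
        sum-a′ : suc (sum a′) ≡ sum a
        sum-a′ = trans (+-comm 1 (sum a′)) (trans (cong (sum a′ +_) (sym (sum-δ i)))
                   (trans (sym (∑-distrib-+ a′ (δ i))) (sum-cong-≗ λ j → m∸n+n≡m (δ≤a j))))
          where
          δ≤a : ∀ j → δ i j ≤ a j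
          δ≤a j with i Fin.≟ j
          ... | yes refl = subst (1 ≤_) (sym eq) (s≤s z≤n)
          ... | no _     = z≤n
        order′ : ∑[ x < N ] ⟦ A′? x ⟧ ≡ q
        order′ = suc-injective (trans (+-comm 1 _) (trans (cong (∑[ x < N ] ⟦ A′? x ⟧ +_) (sym (sum-δ v)))
                   (trans (sym (∑-distrib-+ (λ x → ⟦ A′? x ⟧) (δ v))) (trans (sum-cong-≗ split) order))))
          where
          split : ∀ x → ⟦ A′? x ⟧ + δ v x ≡ α x
          split x with v Fin.≟ x
          ... | yes refl = trans (cong (_+ 1) (⟦⟧-no (A? v ×-dec ¬? (yes refl)) λ (_ , v≢v) → v≢v refl))
                                 (sym (⟦⟧-yes (A? v) av))
          ... | no v≢x = trans (+-identityʳ _) (⟦⟧-cong (A? x ×-dec ¬? (no v≢x)) (A? x) proj₁ (_, v≢x))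
        extend : ∀ {j f} → IsMatching (Within A′ j) f → IsMatching (Within A j) f
        extend mf = record
          { involutive = involutive mf
          ; edge = λ x moves → let x≢fx , (ax , _) , (afx , _) , col = edge mf x moves in x≢fx , ax , afx , col }
        bounded′ : ∀ j f → IsMatching (Within A′ j) f → size f ≤ a′ j
        bounded′ j f mf with i Fin.≟ j
        ... | no _     = bounded j f (extend mf)
        -- A matching that avoids the deleted vertex cannot have size `a i`, by `none`, so it is
        -- smaller by at least one.
        ... | yes refl = ≤-trans (≤-pred (≤∧≢⇒< (subst (size f ≤_) eq (bounded i f (extend mf)))
                                                λ sf → none (f , extend mf , sf , fixes-v)))
                                 (≤-reflexive (cong (_∸ 1) (sym eq)))
          where
          fixes-v : f v ≡ v
          fixes-v = decidable-stable (f v Fin.≟ v) λ moves →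
            let _ , (_ , v≢v) , _ = edge mf v moves in v≢v refl

      sum-α : sum α ≡ suc q
      sum-α = order

      e : Fin k → Fin N → Fin N → ℕ
      e i x y = ⟦ within? A? i x y ⟧

      edges≤ : ∀ i → ∑[ x < N ] sum (e i x) ≤ a i * (4 * b + 2)
      edges≤ i = decidable-stable (_ ≤? _) λ ¬bound →
        -- `edge-bound` needs a matching of size exactly `a i`; `spare` at an arbitrary vertex of
        -- `A` supplies one.
        let v , αv>0 = sum-positive α (subst (0 <_) (sym sum-α) (s≤s z≤n)) in
        spare v (⟦⟧-positive (A? v) αv>0) i λ (f , mf , sf , _) → ¬bound (begin
          ∑[ x < N ] sum (e i x)
            ≤⟨ edge-bound mf sf (bounded i) (λ u (_ , _ , au , _) → spare u au i) ⟩
          (a i + a i) * (a i + a i) + (a i + a i)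
            ≡⟨ solve 1 (λ a → (a :+ a) :* (a :+ a) :+ (a :+ a) := a :* (con 4 :* a :+ con 2)) refl (a i) ⟩
          a i * (4 * a i + 2)
            ≤⟨ *-monoʳ-≤ (a i) (+-monoˡ-≤ 2 (*-monoʳ-≤ 4 (a≤b i))) ⟩
          a i * (4 * b + 2) ∎)
        where
        open ≤-Reasoning
        open +-*-Solver
        open Matchings (Within A i) (within? A? i) (Within-sym {A} {i}) (Within-irrefl {A} {i})

      -- A pair of vertices of `A` is diagonal or an edge of its own colour `c x y`.
      pair-covered : ∀ x y → α x * α y ≤ δ x y * α x + ∑[ i < k ] e i x y
      pair-covered x y with A? x | A? y
      ... | no _   | _     = z≤n
      ... | yes _  | no _  = z≤n
      ... | yes ax | yes ay with x Fin.≟ y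
      ...   | yes _ = s≤s z≤n
      ...   | no x≢y = ≤-trans
        (≤-reflexive (sym (⟦⟧-yes (edge-of-colour? (c x y)) (x≢y , ax , ay , refl))))
        (term≤sum (λ i → ⟦ edge-of-colour? i ⟧) (c x y))
        where
        edge-of-colour? : ∀ i → Dec (Within A i x y)
        edge-of-colour? i = ¬? (no x≢y) ×-dec yes ax ×-dec yes ay ×-dec (c x y Fin.≟ i)

      pairs : suc q * suc q ≤ suc q + sum a * (4 * b + 2)
      pairs = begin
        suc q * suc q                              ≡⟨ sym (cong₂ _*_ sum-α sum-α) ⟩
        sum α * sum α                              ≡⟨ *-distribʳ-sum (sum α) α ⟩
        ∑[ x < N ] (α x * sum α)                   ≡⟨ sum-cong-≗ (λ x → *-distribˡ-sum (α x) α) ⟩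
        ∑[ x < N ] ∑[ y < N ] (α x * α y)          ≤⟨ sum-mono (λ x → sum-mono (pair-covered x)) ⟩
        ∑[ x < N ] ∑[ y < N ] (δ x y * α x + ∑[ i < k ] e i x y)
          ≡⟨ sum-cong-≗ (λ x → ∑-distrib-+ (λ y → δ x y * α x) (λ y → ∑[ i < k ] e i x y)) ⟩
        ∑[ x < N ] (∑[ y < N ] (δ x y * α x) + ∑[ y < N ] ∑[ i < k ] e i x y)
          ≡⟨ ∑-distrib-+ (λ x → ∑[ y < N ] (δ x y * α x)) (λ x → ∑[ y < N ] ∑[ i < k ] e i x y) ⟩
        ∑[ x < N ] ∑[ y < N ] (δ x y * α x) + ∑[ x < N ] ∑[ y < N ] ∑[ i < k ] e i x y
          ≡⟨ cong₂ _+_ diagonal (trans (sum-cong-≗ (λ x → ∑-comm (λ y i → e i x y)))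
                                       (∑-comm (λ x i → sum (e i x)))) ⟩
        suc q + ∑[ i < k ] ∑[ x < N ] sum (e i x)  ≤⟨ +-monoʳ-≤ (suc q) (sum-mono edges≤) ⟩
        suc q + ∑[ i < k ] (a i * (4 * b + 2))     ≡⟨ cong (suc q +_) (sym (*-distribʳ-sum (4 * b + 2) a)) ⟩
        suc q + sum a * (4 * b + 2)                ∎
        where
        open ≤-Reasoning
        diagonal : ∑[ x < N ] ∑[ y < N ] (δ x y * α x) ≡ suc q
        diagonal = trans (sum-cong-≗ λ x → trans (sym (*-distribʳ-sum (α x) (δ x)))
                            (trans (cong (_* α x) (sum-δ x)) (*-identityˡ (α x)))) sum-α

      absurd : ⊥
      -- `suc q * suc q` unfolds to `suc q + q * suc q`, so the diagonal cancels.
      absurd = <⇒≱ (few-pairs b (sum a) q b+s<q) (+-cancelˡ-≤ (suc q) _ _ pairs)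

  -- Otherwise `order-bound` applies with `b` and every `a i` equal to n.
  monochromatic-matching : ∀ n → suc (n + k * n) < N →
    ¬ ¬ ∃ λ i → ∃ λ f → IsMatching (Within (λ _ → ⊤) i) f × n < size f
  monochromatic-matching n large none = <⇒≱ large (subst (λ s → N ≤ suc (n + s)) (sum-const k n)
    (order-bound n N (λ _ → yes tt) (λ _ → n) (trans (sum-const N 1) (*-identityʳ N)) (λ _ → ≤-refl)
      λ i f mf → ≮⇒≥ λ n<size → none (i , f , mf , n<size)))

-- Duplicate-free lists, exhaustive search and decidability of copy counts.

lookup-injective : ∀ {A : Set} {xs : List A} → Unique xs →
  ∀ {i j} → List.lookup xs i ≡ List.lookup xs j → i ≡ j
lookup-injective (_    ∷ _)  {zero}  {zero}  _  = refl
lookup-injective (x∉xs ∷ _)  {zero}  {suc j} eq = contradiction eq (All.lookup x∉xs (∈-lookup j))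
lookup-injective (x∉xs ∷ _)  {suc i} {zero}  eq = contradiction (sym eq) (All.lookup x∉xs (∈-lookup i))
lookup-injective (_    ∷ xs) {suc i} {suc j} eq = cong suc (lookup-injective xs eq)

-- Sending each index of `xs` to the index of a related entry of `ys` is injective. A relation is
-- used because a subgraph is compared with a function only pointwise.
length-≤ : ∀ {A B : Set} (R : A → B → Set) {xs : List A} {ys : List B} → Unique xs →
  (∀ {x} → x List.∈ xs → ∃ λ y → y List.∈ ys × R x y) →
  (∀ {x x′ y} → R x y → R x′ y → x ≡ x′) → length xs ≤ length ys
length-≤ R {xs} {ys} unique image determined = Fin.injective⇒≤ {f = f} λ {i} {j} fi≡fj →
  lookup-injective unique (determined (related i)
    (subst (λ l → R (List.lookup xs j) (List.lookup ys l)) (sym fi≡fj) (related j)))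
  where
  f : Fin (length xs) → Fin (length ys)
  f i = Any.index (proj₁ (proj₂ (image (∈-lookup i))))
  related : ∀ i → R (List.lookup xs i) (List.lookup ys (f i))
  related i with image (∈-lookup i)
  ... | y , y∈ys , r = subst (R _) (lookup-index y∈ys) r

Finite : Set → Set
Finite A = Σ (List A) λ xs → ∀ x → x List.∈ xs

search : ∀ {A : Set} {P : A → Set} → Finite A → (∀ x → Dec (P x)) → Dec (∃ P)
search (xs , complete) P? = map′ Any.satisfied (λ (x , px) → List.lose (complete x) px) (Any.any? P? xs)

finite-Bool : Finite Bool
finite-Bool = true ∷ false ∷ [] , λ { true → here refl ; false → there (here refl) }

finite-Fin : ∀ n → Finite (Fin n)
finite-Fin n = allFin n , ∈-allFin

finite-Vec : ∀ {A} → Finite A → ∀ n → Finite (Vec A n)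
finite-Vec fin zero = [] ∷ [] , λ { [] → here refl }
finite-Vec fin@(xs , complete) (suc n) with finite-Vec fin n
... | vs , completeᵥ = cartesianProductWith _∷_ xs vs ,
                       λ { (x ∷ v) → ∈-cartesianProductWith⁺ _∷_ (complete x) (completeᵥ v) }

-- Functions are searched through their tables, so `P` has to respect pointwise equality.
search-→ : ∀ {m} {A : Set} {P : (Fin m → A) → Set} → Finite A →
  (∀ {f g} → f ≗ g → P f → P g) → (∀ f → Dec (P f)) → Dec (∃ P)
search-→ {m} fin ext P? = map′ (λ (v , p) → lookup v , p)
  (λ (f , p) → tabulate f , ext (sym ∘ lookup∘tabulate f) p)
  (search (finite-Vec fin m) (P? ∘ lookup))

infix 3 _⇔-dec_

_⇔-dec_ : {P Q : Set} → Dec P → Dec Q → Dec (P ⇔ Q)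
p? ⇔-dec q? = map′ (uncurry mk⇔) (λ e → to e , from e) ((p? →-dec q?) ×-dec (q? →-dec p?))

module _ {N : ℕ} where

  edge? : (nb : Vec (Subset N) N) → Decidable (λ i j → j ∈ lookup nb i)
  edge? nb i j = j ∈? lookup nb i

  -- The irrelevant fields of `Subgraph` in relevant form, so that they can be decided.
  Laws : Subset N → Vec (Subset N) N → Set
  Laws V nb = (∀ i j → j ∈ lookup nb i → i ∈ lookup nb j)
            × (∀ i → ¬ i ∈ lookup nb i)
            × (∀ i j → j ∈ lookup nb i → i ∈ V)

  laws? : ∀ V nb → Dec (Laws V nb)
  laws? V nb = Fin.all? (λ i → Fin.all? λ j → edge? nb i j →-dec edge? nb j i)
         ×-dec Fin.all? (λ i → ¬? (edge? nb i i))
         ×-dec Fin.all? (λ i → Fin.all? λ j → edge? nb i j →-dec i ∈? V)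

  lawful : ∀ V nb → Dec (Laws V nb) → List (Subgraph N)
  lawful V nb (no _)             = []
  lawful V nb (yes (sy , ir , inc)) =
    record { vertices = V ; neighbours = nb ; symm = sy ; irrefl = ir ; incident = inc } ∷ []

  finite-Subgraph : Finite (Subgraph N)
  finite-Subgraph = subgraphs , complete
    where
    subsets : Finite (Subset N)
    subsets = finite-Vec finite-Bool N
    matrices : Finite (Vec (Subset N) N)
    matrices = finite-Vec subsets N
    with-vertices : Subset N → List (Subgraph N)
    with-vertices V = concatMap (λ nb → lawful V nb (laws? V nb)) (proj₁ matrices)
    subgraphs : List (Subgraph N)
    subgraphs = concatMap with-vertices (proj₁ subsets)
    complete : ∀ S → S List.∈ subgraphs
    complete S@record { vertices = V ; neighbours = nb ; symm = sy ; irrefl = ir ; incident = inc } =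
      ∈-concatMap⁺ with-vertices (List.lose (proj₂ subsets V)
        (∈-concatMap⁺ _ (List.lose (proj₂ matrices nb) (found (laws? V nb)))))
      where
      found : (d : Dec (Laws V nb)) → S List.∈ lawful V nb d
      found (yes _)    = here refl
      -- The laws of `S` are irrelevant, which is enough to refute `¬laws`.
      found (no ¬laws) = contradiction-irr {A = Laws V nb} (sy , ir , inc) ¬laws

  Subgraph-≡ : {S T : Subgraph N} → vertices S ≡ vertices T →
    Subgraph.neighbours S ≡ Subgraph.neighbours T → S ≡ T
  Subgraph-≡ refl refl = refl

  _≟ₛ_ : DecidableEquality (Subgraph N)
  S ≟ₛ T = map′ (uncurry Subgraph-≡) (λ { refl → refl , refl })
    (≡-dec Bool._≟_ (vertices S) (vertices T)
      ×-dec ≡-dec (≡-dec Bool._≟_) (Subgraph.neighbours S) (Subgraph.neighbours T))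

  Edge? : (S : Subgraph N) → Decidable (Edge S)
  Edge? S i j = j ∈? lookup (Subgraph.neighbours S) i

  isCopyOf? : ∀ G (S : Subgraph N) → Dec (IsCopyOf G S)
  isCopyOf? G S = search-→ (finite-Fin N) ext λ f →
          map′ (λ inj {a} {b} → inj a b) (λ inj a b → inj)
            (Fin.all? λ a → Fin.all? λ b → (f a Fin.≟ f b) →-dec (a Fin.≟ b))
    ×-dec Fin.all? (λ i → (i ∈? vertices S) ⇔-dec Fin.any? λ a → f a Fin.≟ i)
    ×-dec Fin.all? (λ a → Fin.all? λ b → adj? a b ⇔-dec Edge? S (f a) (f b))
    where
    open Graph G
    ext : ∀ {f g : Fin order → Fin N} → f ≗ g →
      (Injective _≡_ _≡_ f × (∀ i → i ∈ vertices S ⇔ ∃ λ a → f a ≡ i) × (∀ a b → Adj a b ⇔ Edge S (f a) (f b))) →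
      (Injective _≡_ _≡_ g × (∀ i → i ∈ vertices S ⇔ ∃ λ a → g a ≡ i) × (∀ a b → Adj a b ⇔ Edge S (g a) (g b)))
    ext f≗g (inj , onto , adj) =
        (λ {a} {b} ga≡gb → inj (trans (f≗g a) (trans ga≡gb (sym (f≗g b)))))
      , (λ i → mk⇔ (λ i∈S → let a , fa≡i = to (onto i) i∈S in a , trans (sym (f≗g a)) fa≡i)
                   (λ (a , ga≡i) → from (onto i) (a , trans (f≗g a) ga≡i)))
      , λ a b → subst₂ (λ x y → Adj a b ⇔ Edge S x y) (f≗g a) (f≗g b) (adj a b)

  module _ {k : ℕ} (c : Colouring k N) where

    exact? : Dec (Exact c)
    exact? = Fin.all? λ x → Fin.any? λ i → Fin.any? λ j → ¬? (i Fin.≟ j) ×-dec (colour c i j Fin.≟ x)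

    rainbow? : ∀ S → Dec (Rainbow c S)
    rainbow? S = map′ (λ r {i} {j} {u} {v} → r i j u v) (λ r i j u v → r)
      (Fin.all? λ i → Fin.all? λ j → Fin.all? λ u → Fin.all? λ v →
      Edge? S i j →-dec (Edge? S u v →-dec ((colour c i j Fin.≟ colour c u v) →-dec
      (((i Fin.≟ u) ×-dec (j Fin.≟ v)) ⊎-dec ((i Fin.≟ v) ×-dec (j Fin.≟ u))))))

    monochromatic? : ∀ S → Dec (Monochromatic c S)
    monochromatic? S = map′ (λ r {i} {j} {u} {v} → r i j u v) (λ r i j u v → r)
      (Fin.all? λ i → Fin.all? λ j → Fin.all? λ u → Fin.all? λ v →
      Edge? S i j →-dec (Edge? S u v →-dec (colour c i j Fin.≟ colour c u v)))

    rainbowCopy? : ∀ G S → Dec (RainbowCopy c G S)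
    rainbowCopy? G S = isCopyOf? G S ×-dec rainbow? S

    monochromaticCopy? : ∀ H S → Dec (MonochromaticCopy c H S)
    monochromaticCopy? H S = isCopyOf? H S ×-dec monochromatic? S

  cardinality : ∀ {P : Subgraph N → Set} → (∀ S → Dec (P S)) → ∃ (HasCardinality P)
  cardinality {P} P? = length xs , xs , filter⁺ P? (deduplicate-! _≟ₛ_ (proj₁ finite-Subgraph))
    , (λ S → mk⇔ (λ S∈ → proj₂ (∈-filter⁻ P? {xs = all} S∈))
               (λ p → ∈-filter⁺ P? (∈-deduplicate⁺ _≟ₛ_ (proj₂ finite-Subgraph S)) p)) , refl
    where
    all xs : List (Subgraph N)
    all = deduplicate _≟ₛ_ (proj₁ finite-Subgraph)
    xs  = filter P? all

cardinality-unique : ∀ {A : Set} {P : A → Set} {s t} → HasCardinality P s → HasCardinality P t → s ≡ t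
cardinality-unique {P = P} {s} {t} hs ht = ≤-antisym (below hs ht) (below ht hs)
  where
  below : ∀ {s t} → HasCardinality P s → HasCardinality P t → s ≤ t
  below (xs , ux , x⇔ , refl) (ys , uy , y⇔ , refl) = length-≤ _≡_ ux
    (λ {x} x∈xs → x , from (y⇔ x) (to (x⇔ x) x∈xs) , refl) λ p q → trans p (sym q)

cardinality-cong : ∀ {A : Set} {P Q : A → Set} {t} → (∀ x → P x → Q x) → (∀ x → Q x → P x) →
  HasCardinality P t → HasCardinality Q t
cardinality-cong P⇒Q Q⇒P (xs , unique , x⇔ , len) =
  xs , unique , (λ x → mk⇔ (P⇒Q x ∘ to (x⇔ x)) (from (x⇔ x) ∘ Q⇒P x)) , len

module _ {k N : ℕ} (G H : Graph) where

  copyCount : (c : Colouring k N) → ∃ (CopyCount c G H)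
  copyCount c with cardinality (rainbowCopy? c G) | cardinality (monochromaticCopy? c H)
  ... | r , hr | s , hs = r + s , r , s , hr , hs , refl

  copyCount? : (c : Colouring k N) → ∀ t → Dec (CopyCount c G H t)
  copyCount? c t with copyCount c
  ... | t₀ , cc@(r , s , hr , hs , eq) with t₀ ≟ t
  ...   | yes refl = yes cc
  ...   | no t₀≢t = no λ (r′ , s′ , hr′ , hs′ , eq′) →
            t₀≢t (trans (sym eq) (trans (cong₂ _+_ (cardinality-unique hr hr′) (cardinality-unique hs hs′)) eq′))

  -- Allows a colouring to be replaced by its matrix of colours, with which it agrees only
  -- pointwise.
  copyCount-cong : (c d : Colouring k N) → (∀ i j → colour c i j ≡ colour d i j) →
    ∀ {t} → CopyCount c G H t → CopyCount d G H t
  copyCount-cong c d c≗d (r , s , hr , hs , eq) = r , s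
    , cardinality-cong (rainbow-cong c d c≗d) (rainbow-cong d c d≗c) hr
    , cardinality-cong (mono-cong c d c≗d) (mono-cong d c d≗c) hs
    , eq
    where
    d≗c : ∀ i j → colour d i j ≡ colour c i j
    d≗c i j = sym (c≗d i j)
    rainbow-cong : (c d : Colouring k N) → (∀ i j → colour c i j ≡ colour d i j) →
      ∀ S → RainbowCopy c G S → RainbowCopy d G S
    rainbow-cong c d c≗d S (copy , rainbow) = copy , λ {i} {j} {u} {v} ij uv same →
      rainbow ij uv (trans (c≗d i j) (trans same (sym (c≗d u v))))
    mono-cong : (c d : Colouring k N) → (∀ i j → colour c i j ≡ colour d i j) →
      ∀ S → MonochromaticCopy c H S → MonochromaticCopy d H S
    mono-cong c d c≗d S (copy , mono) = copy , λ {i} {j} {u} {v} ij uv →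
      trans (sym (c≗d i j)) (trans (mono ij uv) (c≗d u v))

  -- Up to pointwise equality the colourings are the symmetric matrices over `Fin k`, of which there
  -- are finitely many.
  exactCount? : ∀ t → Dec (Σ (Colouring k N) λ c → Exact c × CopyCount c G H t)
  exactCount? t = map′
    (λ (m , sy , p) → ofMatrix m sy , p)
    (λ (c , exact , count) → matrix c , matrix-symm c ,
       (λ x → let i , j , i≢j , eq = exact x in i , j , i≢j , trans (matrix-colour c i j) eq) ,
       copyCount-cong c (ofMatrix (matrix c) (matrix-symm c)) (λ i j → sym (matrix-colour c i j)) count)
    (search (finite-Vec (finite-Vec (finite-Fin k) N) N) good?)
    where
    entry : Vec (Vec (Fin k) N) N → Fin N → Fin N → Fin k
    entry m i j = lookup (lookup m i) j
    SymmetricMatrix : Vec (Vec (Fin k) N) N → Set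
    SymmetricMatrix m = ∀ i j → entry m i j ≡ entry m j i
    ofMatrix : ∀ m → SymmetricMatrix m → Colouring k N
    ofMatrix m sy = record { colour = entry m ; symm = sy }
    Good : Vec (Vec (Fin k) N) N → Set
    Good m = Σ (SymmetricMatrix m) λ sy → Exact (ofMatrix m sy) × CopyCount (ofMatrix m sy) G H t
    good? : ∀ m → Dec (Good m)
    good? m with Fin.all? (λ i → Fin.all? λ j → entry m i j Fin.≟ entry m j i)
    ... | no ¬sy = no (¬sy ∘ proj₁)
    ... | yes sy with exact? (ofMatrix m sy) ×-dec copyCount? (ofMatrix m sy) t
    ...   | yes p = yes (sy , p)
    ...   | no ¬p = no λ (sy′ , exact , count) →
            ¬p (exact , copyCount-cong (ofMatrix m sy′) (ofMatrix m sy) (λ _ _ → refl) count)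
    matrix : Colouring k N → Vec (Vec (Fin k) N) N
    matrix c = tabulate λ i → tabulate (colour c i)
    matrix-colour : ∀ c i j → entry (matrix c) i j ≡ colour c i j
    matrix-colour c i j = trans (cong (λ row → lookup row j) (lookup∘tabulate _ i)) (lookup∘tabulate (colour c i) j)
    matrix-symm : ∀ c → SymmetricMatrix (matrix c)
    matrix-symm c i j = trans (matrix-colour c i j) (trans (Colouring.symm c i j) (sym (matrix-colour c j i)))

minimum : ∀ {P : ℕ → Set} → (∀ t → Dec (P t)) → ∀ {t} → P t → ∃ (IsMinimum P)
minimum {P} P? {t} p with below (suc t)
  where
  below : ∀ b → ∃ (IsMinimum P) ⊎ (∀ {s} → s < b → ¬ P s)
  below zero = inj₂ λ ()
  below (suc b) with below b
  ... | inj₁ found = inj₁ found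
  ... | inj₂ none with P? b
  ...   | yes pb = inj₁ (b , pb , λ s ps → ≮⇒≥ λ s<b → none s<b ps)
  ...   | no ¬pb = inj₂ λ {s} s<1+b ps →
            [ (λ s<b → none s<b ps) , (λ { refl → ¬pb ps }) ]′ (m≤n⇒m<n∨m≡n (≤-pred s<1+b))
... | inj₁ found = found
... | inj₂ none  = contradiction p (none ≤-refl)

-- Copies as images of injective maps.

subset : ∀ {n} {P : Fin n → Set} → (∀ i → Dec (P i)) → Subset n
subset P? = tabulate (does ∘ P?)

∈-subset : ∀ {n} {P : Fin n → Set} (P? : ∀ i → Dec (P i)) i → i ∈ subset P? ⇔ P i
∈-subset P? i = mk⇔ (λ i∈ → ⇒ (P? i) (trans (sym (lookup∘tabulate (does ∘ P?) i)) ([]=⇒lookup i∈)))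
                    (λ p → lookup⇒[]= i _ (trans (lookup∘tabulate (does ∘ P?) i) (⇐ (P? i) p)))
  where
  ⇒ : ∀ {A : Set} (d : Dec A) → does d ≡ true → A
  ⇒ (yes a) _ = a
  ⇐ : ∀ {A : Set} (d : Dec A) → A → does d ≡ true
  ⇐ (yes _) _ = refl
  ⇐ (no ¬a) a = contradiction a ¬a

module Image (G : Graph) {N : ℕ} (h : Fin (Graph.order G) → Fin N) (h-injective : Injective _≡_ _≡_ h) where
  open Graph G

  Joined : Fin N → Fin N → Set
  Joined i j = ∃₂ λ a b → Adj a b × h a ≡ i × h b ≡ j

  joined? : ∀ i j → Dec (Joined i j)
  joined? i j = Fin.any? λ a → Fin.any? λ b → adj? a b ×-dec (h a Fin.≟ i) ×-dec (h b Fin.≟ j)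

  hit? : ∀ i → Dec (∃ λ a → h a ≡ i)
  hit? i = Fin.any? λ a → h a Fin.≟ i

  rows : Vec (Subset N) N
  rows = tabulate λ i → subset (joined? i)

  ∈-rows : ∀ i j → j ∈ lookup rows i ⇔ Joined i j
  ∈-rows i j = subst (λ p → j ∈ p ⇔ Joined i j) (sym (lookup∘tabulate (λ i → subset (joined? i)) i))
    (∈-subset (joined? i) j)

  image : Subgraph N
  image = record
    { vertices   = subset hit?
    ; neighbours = rows
    ; symm       = λ i j e → let a , b , ab , ha , hb = to (∈-rows i j) e in
                             from (∈-rows j i) (b , a , symm ab , hb , ha)
    ; irrefl     = λ i e → let a , b , ab , ha , hb = to (∈-rows i i) e in
                           irrefl (h-injective (trans ha (sym hb))) ab
    ; incident   = λ i j e → let a , b , ab , ha , hb = to (∈-rows i j) e in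
                             from (∈-subset hit? i) (a , ha)
    }

  image-isCopy : IsCopyOf G image
  image-isCopy = h , h-injective , ∈-subset hit? , λ a b → mk⇔
    (λ ab → from (∈-rows (h a) (h b)) (a , b , ab , refl , refl))
    (λ e → let a′ , b′ , ab , ha , hb = to (∈-rows (h a) (h b)) e in
           subst₂ Adj (h-injective ha) (h-injective hb) ab)

-- The partner map of `n K₂`, and copies obtained from matchings.

mate : ∀ {n} → Fin (n * 2) → Fin (n * 2)
mate {n} z = combine (quotient {n} 2 z) (opposite (remainder {n} 2 z))

opposite-Fin2 : ∀ (r s : Fin 2) → r ≢ s → s ≡ opposite r
opposite-Fin2 zero       zero       r≢s = contradiction refl r≢s
opposite-Fin2 zero       (suc zero) r≢s = refl
opposite-Fin2 (suc zero) zero       r≢s = refl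
opposite-Fin2 (suc zero) (suc zero) r≢s = contradiction refl r≢s

opposite-≢ : ∀ (r : Fin 2) → r ≢ opposite r
opposite-≢ zero       ()
opposite-≢ (suc zero) ()

remQuot-mate : ∀ {n} z → remQuot {n} 2 (mate {n} z) ≡ (quotient {n} 2 z , opposite (remainder {n} 2 z))
remQuot-mate {n} z = Fin.remQuot-combine (quotient {n} 2 z) (opposite (remainder {n} 2 z))

Adj-mate : ∀ {n} z → Graph.Adj (n K₂) z (mate {n} z)
Adj-mate {n} z = (λ z≡mz → opposite-≢ _ (trans (cong (remainder {n} 2) z≡mz) (cong proj₂ (remQuot-mate {n} z))))
               , sym (cong proj₁ (remQuot-mate {n} z))

Adj⇒mate : ∀ {n} {y z} → Graph.Adj (n K₂) y z → z ≡ mate {n} y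
Adj⇒mate {n} {y} {z} (y≢z , q) = trans (sym (Fin.combine-remQuot {n} 2 z))
  (cong₂ combine (sym q) (opposite-Fin2 _ _ λ r → y≢z (trans (sym (Fin.combine-remQuot {n} 2 y))
    (trans (cong₂ combine q r) (Fin.combine-remQuot {n} 2 z)))))

mate-involutive : ∀ {n} z → mate {n} (mate {n} z) ≡ z
mate-involutive {n} z = sym (Adj⇒mate {n} (Graph.symm (n K₂) (Adj-mate {n} z)))

-- The a-th edge of `n K₂` is sent to the edge of `f` whose smaller endpoint is `e a`.
matching⇒copy : ∀ {k N n} (c : Colouring k N) {A i f} →
  IsMatching (Stripes.Within (colour c) (Colouring.symm c) A i) f → n ≤ size f → ∃ (MonochromaticCopy c (n K₂))
matching⇒copy {N = N} {n} c {i = i} {f} mf n≤size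
  with e , e-injective , ascending ← injection-of-sum (λ x → x Fin.<? f x) n≤size =
    image , image-isCopy , λ {x} {y} {u} {v} xy uv → trans (coloured x y xy) (sym (coloured u v uv))
  where
  end : Fin n → Fin 2 → Fin N
  end a zero    = e a
  end a (suc _) = f (e a)

  h : Fin (n * 2) → Fin N
  h z = end (quotient {n} 2 z) (remainder {n} 2 z)

  -- Equality would make `e a` and `e b` partners, each below the other.
  clash : ∀ {a b} → e a ≢ f (e b)
  clash {a} {b} ea≡feb = Fin.<-asym (ascending a)
    (subst₂ Fin._<_ (trans (sym (involutive mf (e b))) (cong f (sym ea≡feb))) (sym ea≡feb) (ascending b))

  end-injective : ∀ a r b s → end a r ≡ end b s → a ≡ b × r ≡ s
  end-injective a zero       b zero       eq = e-injective eq , refl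
  end-injective a zero       b (suc zero) eq = contradiction eq clash
  end-injective a (suc zero) b zero       eq = contradiction (sym eq) clash
  end-injective a (suc zero) b (suc zero) eq =
    e-injective (trans (sym (involutive mf (e a))) (trans (cong f eq) (involutive mf (e b)))) , refl

  end-opposite : ∀ a r → end a (opposite r) ≡ f (end a r)
  end-opposite a zero       = refl
  end-opposite a (suc zero) = sym (involutive mf (e a))

  h-injective : Injective _≡_ _≡_ h
  h-injective {y} {z} eq
    with q , r ← end-injective (quotient {n} 2 y) (remainder {n} 2 y) (quotient {n} 2 z) (remainder {n} 2 z) eq =
    trans (sym (Fin.combine-remQuot {n} 2 y)) (trans (cong₂ combine q r) (Fin.combine-remQuot {n} 2 z))

  open Image (n K₂) h h-injective

  h-mate : ∀ z → h (mate {n} z) ≡ f (h z)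
  h-mate z = trans (cong (uncurry end) (remQuot-mate {n} z)) (end-opposite (quotient {n} 2 z) (remainder {n} 2 z))

  coloured : ∀ x y → Edge image x y → colour c x y ≡ i
  coloured x y xy with a , b , ab , refl , refl ← to (∈-rows x y) xy
    with refl ← Adj⇒mate {n} ab =
      trans (cong (colour c (h a)) (h-mate a)) (proj₂ (proj₂ (proj₂ (edge mf (h a) λ fixed →
        proj₁ ab (h-injective (sym (trans (h-mate a) fixed)))))))

-- Enumeration of perfect matchings and the double factorial.

select : {A : Set} → List A → List (A × List A)
select []       = []
select (x ∷ xs) = (x , xs) ∷ List.map (map₂ (x ∷_)) (select xs)

length-select : {A : Set} (xs : List A) → length (select xs) ≡ length xs
length-select []       = refl
length-select (x ∷ xs) = cong suc (trans (List.length-map _ (select xs)) (length-select xs))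

select-complete : ∀ {A : Set} {y : A} {xs} → y List.∈ xs → ∃ λ r → (y , r) List.∈ select xs × xs ↭ y ∷ r
select-complete (here refl) = _ , here refl , ↭-refl
select-complete {xs = x ∷ _} (there y∈xs) with r , ∈select , xs↭ ← select-complete y∈xs =
  x ∷ r , there (∈-map⁺ _ ∈select) , ↭-trans (prep x xs↭) (swap x _ ↭-refl)

-- The fixed-point-free involutions of a list of 2m vertices, once each; off the list they are id.
pairings : ∀ {N} → ℕ → List (Fin N) → List (Fin N → Fin N)
pairings (suc m) (x ∷ xs) = concatMap (λ (y , r) → List.map (λ e → insert e x y) (pairings m r)) (select xs)
pairings _       _        = id ∷ []

length-concatMap : ∀ {A B : Set} (f : A → List B) c (xs : List A) → (∀ {x} → x List.∈ xs → length (f x) ≡ c) →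
  length (concatMap f xs) ≡ length xs * c
length-concatMap f c []       _    = refl
length-concatMap f c (x ∷ xs) each = trans (List.length-++ (f x))
  (cong₂ _+_ (each (here refl)) (length-concatMap f c xs (each ∘ there)))

select-length : ∀ {A : Set} (xs : List A) {y r} → (y , r) List.∈ select xs → length xs ≡ suc (length r)
select-length (x ∷ xs) (here refl) = refl
select-length (x ∷ xs) (there ∈map)
  with (y , r) , ∈select , refl ← ∈-map⁻ (map₂ (x ∷_)) ∈map = cong suc (select-length xs ∈select)

-- At m = 0 truncated subtraction yields `0 !!`, whose value 1 is the conventional (-1)!!.
odd-!!-step : ∀ m → (2 * suc m ∸ 1) !! ≡ suc (m * 2) * (2 * m ∸ 1) !!
odd-!!-step zero    = refl
odd-!!-step (suc m) = trans (cong _!! shift) (cong (λ t → suc t * (2 * suc m ∸ 1) !!) (*-comm 2 (suc m)))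
  where
  shift : 2 * suc (suc m) ∸ 1 ≡ suc (suc (2 * suc m ∸ 1))
  shift = cong suc (+-suc m (suc (m + 0)))

-- With 2m + 2 vertices, the first one has 2m + 1 possible partners, each leaving 2m vertices to be
-- paired.
length-pairings : ∀ {N} m (xs : List (Fin N)) → length xs ≡ m * 2 → length (pairings m xs) ≡ (2 * m ∸ 1) !!
length-pairings zero    _        _  = refl
length-pairings (suc m) (x ∷ xs) eq = trans
  (length-concatMap _ ((2 * m ∸ 1) !!) (select xs) λ { {y , r} ∈select → trans (List.length-map _ (pairings m r))
    (length-pairings m r (suc-injective (trans (sym (select-length xs ∈select)) (suc-injective eq)))) })
  (trans (cong (_* (2 * m ∸ 1) !!) (trans (length-select xs) (suc-injective eq))) (sym (odd-!!-step m)))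

-- The first vertex is paired with its `ρ`-partner; what remains is again closed under `ρ`.
-- Agreement is claimed on the list only, since the enumerated maps are the identity elsewhere.
pairings-complete : ∀ {N} (ρ : Fin N → Fin N) → (∀ x → ρ (ρ x) ≡ x) → (∀ x → ρ x ≢ x) →
  ∀ m (xs : List (Fin N)) → length xs ≡ m * 2 → Unique xs → (∀ {x} → x List.∈ xs → ρ x List.∈ xs) →
  ∃ λ e → e List.∈ pairings m xs × (∀ {x} → x List.∈ xs → ρ x ≡ e x)
pairings-complete ρ inv free zero    []       _  _ _ = id , here refl , λ ()
pairings-complete ρ inv free (suc m) (x ∷ xs) eq unique@(x∉xs ∷ _) closed
  with closed (here refl)
... | here ρx≡x = contradiction ρx≡x (free x)
... | there ρx∈xs
  with r , ∈select , xs↭ ← select-complete ρx∈xs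
  with _ ∷ y∉r ∷ unique-r ← Unique-resp-↭ (setoid _) (↭⇒↭ₛ (prep x xs↭)) unique
  = insert e x (ρ x) , ∈-concatMap⁺ _ (List.lose ∈select (∈-map⁺ _ (proj₁ (proj₂ remaining)))) , agrees
  where
  closed-r : ∀ {z} → z List.∈ r → ρ z List.∈ r
  closed-r {z} z∈r with closed (there (∈-resp-↭ (↭-sym xs↭) (there z∈r)))
  ... | here ρz≡x = contradiction (trans (cong ρ (sym ρz≡x)) (inv z)) (All.lookup y∉r z∈r)
  ... | there ρz∈xs with ∈-resp-↭ xs↭ ρz∈xs
  ...   | there ρz∈r = ρz∈r
  ...   | here ρz≡ρx = contradiction (trans (sym (inv x)) (trans (cong ρ (sym ρz≡ρx)) (inv z)))
                         (All.lookup x∉xs (∈-resp-↭ (↭-sym xs↭) (there z∈r)))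
  remaining : ∃ λ e → e List.∈ pairings m r × (∀ {z} → z List.∈ r → ρ z ≡ e z)
  remaining = pairings-complete ρ inv free m r
    (suc-injective (trans (sym (select-length xs ∈select)) (suc-injective eq))) unique-r closed-r
  e : _
  e = proj₁ remaining
  agrees : ∀ {z} → z List.∈ (x ∷ xs) → ρ z ≡ insert e x (ρ x) z
  agrees {z} z∈ with z Fin.≟ x | z Fin.≟ ρ x
  ... | yes refl | _        = refl
  ... | no _     | yes refl = inv x
  ... | no z≢x   | no z≢ρx with z∈
  ...   | here z≡x = contradiction z≡x z≢x
  ...   | there z∈xs with ∈-resp-↭ xs↭ z∈xs
  ...     | here z≡ρx = contradiction z≡ρx z≢ρx
  ...     | there z∈r = proj₂ (proj₂ remaining) z∈r

-- The layered colouring, where `join` is the maximum on `Fin l`.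

join : ∀ {l} → Fin l → Fin l → Fin l
join zero    j       = j
join (suc i) zero    = suc i
join (suc i) (suc j) = suc (join i j)

join-comm : ∀ {l} (i j : Fin l) → join i j ≡ join j i
join-comm zero    zero    = refl
join-comm zero    (suc j) = refl
join-comm (suc i) zero    = refl
join-comm (suc i) (suc j) = cong suc (join-comm i j)

join-sel : ∀ {l} (i j : Fin l) → join i j ≡ i ⊎ join i j ≡ j
join-sel zero    j       = inj₂ refl
join-sel (suc i) zero    = inj₁ refl
join-sel (suc i) (suc j) = [ inj₁ ∘ cong suc , inj₂ ∘ cong suc ]′ (join-sel i j)

join-zero : ∀ {l} (i j : Fin (suc l)) → join i j ≡ zero → i ≡ zero × j ≡ zero
join-zero zero j j≡0 = refl , j≡0
join-zero (suc i) zero    ()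
join-zero (suc i) (suc j) ()

-- A largest of the three levels is the maximum of both pairs that contain it; hence no triangle is
-- rainbow.
join-two-agree : ∀ {l} (i j m : Fin l) →
  join i j ≡ join i m ⊎ join i j ≡ join j m ⊎ join i m ≡ join j m
join-two-agree zero    zero    m       = inj₂ (inj₂ refl)
join-two-agree zero    (suc j) zero    = inj₂ (inj₁ refl)
join-two-agree (suc i) zero    zero    = inj₁ refl
join-two-agree zero    (suc j) (suc m) with join-sel j m
... | inj₁ e = inj₂ (inj₁ (cong suc (sym e)))
... | inj₂ e = inj₂ (inj₂ (cong suc (sym e)))
join-two-agree (suc i) zero    (suc m) with join-sel i m
... | inj₁ e = inj₁ (cong suc (sym e))
... | inj₂ e = inj₂ (inj₂ (cong suc e))
join-two-agree (suc i) (suc j) zero with join-sel i j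
... | inj₁ e = inj₁ (cong suc e)
... | inj₂ e = inj₂ (inj₁ (cong suc e))
join-two-agree (suc i) (suc j) (suc m) with join-two-agree i j m
... | inj₁ e        = inj₁ (cong suc e)
... | inj₂ (inj₁ e) = inj₂ (inj₁ (cong suc e))
... | inj₂ (inj₂ e) = inj₂ (inj₂ (cong suc e))

module Layered (b l w : ℕ) where

  V : Set
  V = Fin (b + l * w)

  base : Fin b → V
  base x = x ↑ˡ (l * w)

  upper : Fin l → Fin w → V
  upper q r = b ↑ʳ combine q r

  level : V → Fin (suc l)
  level = [ const zero , suc ∘ quotient {l} w ]′ ∘ splitAt b

  layered : Colouring (suc l) (b + l * w)
  layered = record { colour = λ x y → join (level x) (level y) ; symm = λ x y → join-comm (level x) (level y) }

  level-base : ∀ x → level (base x) ≡ zero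
  level-base x = cong [ const zero , suc ∘ quotient {l} w ]′ (Fin.splitAt-↑ˡ b x (l * w))

  level-upper : ∀ q r → level (upper q r) ≡ suc q
  level-upper q r = trans (cong [ const zero , suc ∘ quotient {l} w ]′ (Fin.splitAt-↑ʳ b (l * w) (combine q r)))
    (cong (suc ∘ proj₁) (Fin.remQuot-combine q r))

  in-base : ∀ x → level x ≡ zero → ∃ λ y → base y ≡ x
  in-base x lx with splitAt b x in eq
  ... | inj₁ y = y , Fin.splitAt⁻¹-↑ˡ eq

  in-upper : ∀ q x → level x ≡ suc q → ∃ λ r → upper q r ≡ x
  in-upper q x lx with splitAt b x in eq
  ... | inj₂ y with refl ← lx =
    remainder {l} w y , trans (cong (b ↑ʳ_) (Fin.combine-remQuot {l} w y)) (Fin.splitAt⁻¹-↑ʳ eq)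

  layered-exact : 2 ≤ b → 1 ≤ w → Exact layered
  layered-exact (s≤s (s≤s _)) (s≤s _) zero = base zero , base (suc zero) ,
    (λ e → Fin.0≢1+n (Fin.↑ˡ-injective (l * w) zero (suc zero) e)) ,
    cong₂ join (level-base zero) (level-base (suc zero))
  layered-exact (s≤s (s≤s _)) (s≤s _) (suc q) = base zero , upper q zero ,
    (λ e → Fin.0≢1+n (trans (sym (level-base zero)) (trans (cong level e) (level-upper q zero)))) ,
    cong₂ join (level-base zero) (level-upper q zero)

  module Distinct {f : Fin 3 → V} (injective : Injective _≡_ _≡_ f) where
    0≢1 : f zero ≢ f (suc zero)
    0≢1 e with () ← injective e
    0≢2 : f zero ≢ f (suc (suc zero))
    0≢2 e with () ← injective e
    1≢2 : f (suc zero) ≢ f (suc (suc zero))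
    1≢2 e with () ← injective e

  no-rainbow-triangle : ∀ S → ¬ RainbowCopy layered (K 3) S
  no-rainbow-triangle S ((f , injective , _ , adj) , rainbow)
    with join-two-agree (level (f zero)) (level (f (suc zero))) (level (f (suc (suc zero))))
  ... | inj₁ e        = [ 1≢2 ∘ proj₂ , 0≢2 ∘ proj₁ ]′ (rainbow (to (adj _ _) λ ()) (to (adj _ _) λ ()) e)
    where open Distinct injective
  ... | inj₂ (inj₁ e) = [ 0≢1 ∘ proj₁ , 0≢2 ∘ proj₁ ]′ (rainbow (to (adj _ _) λ ()) (to (adj _ _) λ ()) e)
    where open Distinct injective
  ... | inj₂ (inj₂ e) = [ 0≢1 ∘ proj₁ , 0≢2 ∘ proj₁ ]′ (rainbow (to (adj _ _) λ ()) (to (adj _ _) λ ()) e)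
    where open Distinct injective

  -- Every edge of a colour i > 0 has an endpoint on level i, and only w vertices lie on that level.
  copies-in-base : ∀ {n} S → w < n → (copy : MonochromaticCopy layered (n K₂) S) →
    ∀ z → ∃ λ y → base y ≡ proj₁ (proj₁ copy) z
  copies-in-base {suc n} S w<n ((h , injective , _ , adj) , mono) z = in-base (h z) (proj₁ (join-zero _ _ colour≡0))
    where
    edge-of : ∀ z → Edge S (h z) (h (mate {suc n} z))
    edge-of z = to (adj z (mate {suc n} z)) (Adj-mate {suc n} z)

    i : Fin (suc l)
    i = colour layered (h z) (h (mate {suc n} z))

    endpoint : ∀ a → ∃ λ r → level (h (combine a r)) ≡ i
    endpoint a with join-sel (level (h x)) (level (h (mate {suc n} x))) | mono (edge-of x) (edge-of z)
      where
      x : Fin (suc n * 2)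
      x = combine a zero
    ... | inj₁ e | same = zero , trans (sym e) same
    ... | inj₂ e | same = r , trans (cong (λ q → level (h (combine q r))) (sym a≡)) (trans (sym e) same)
      where
      r : Fin 2
      r = opposite (remainder {suc n} 2 (combine a zero))
      a≡ : quotient {suc n} 2 (combine a zero) ≡ a
      a≡ = cong proj₁ (Fin.remQuot-combine {suc n} a (zero {1}))

    too-few : ∀ q → i ≢ suc q
    -- Distinct edges have distinct endpoints on the level, so their positions inject the edges into
    -- `Fin w`.
    too-few q i≡ = <⇒≱ w<n (Fin.injective⇒≤ {f = position} λ {a} {a′} eq →
      Fin.combine-injectiveˡ a _ a′ _ (injective (trans (sym (at a)) (trans (cong (upper q) eq) (at a′)))))
      where
      position : Fin (suc n) → Fin w
      position a = proj₁ (in-upper q (h (combine a (proj₁ (endpoint a)))) (trans (proj₂ (endpoint a)) i≡))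
      at : ∀ a → upper q (position a) ≡ h (combine a (proj₁ (endpoint a)))
      at a = proj₂ (in-upper q (h (combine a (proj₁ (endpoint a)))) (trans (proj₂ (endpoint a)) i≡))

    colour≡0 : i ≡ zero
    colour≡0 with i in eq
    ... | zero  = refl
    ... | suc q = contradiction eq (too-few q)

  restrict : ∀ {n} S → w < n → (copy : MonochromaticCopy layered (n K₂) S) →
    ∃ λ (g : Fin (n * 2) → Fin b) → Injective _≡_ _≡_ g × (∀ z → base (g z) ≡ proj₁ (proj₁ copy) z)
  restrict S w<n copy@((h , injective , _) , _) = proj₁ ∘ inside
    , (λ {y} {z} eq → injective (trans (sym (proj₂ (inside y))) (trans (cong base eq) (proj₂ (inside z)))))
    , proj₂ ∘ inside
    where
    inside : ∀ z → ∃ λ y → base y ≡ h z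
    inside = copies-in-base S w<n copy

  -- A copy would place 2n distinct vertices among the b vertices of level 0.
  no-monochromatic-copy : ∀ {n} → w < n → b < n * 2 → ∀ S → ¬ MonochromaticCopy layered (n K₂) S
  no-monochromatic-copy w<n b<2n S copy with g , g-injective , _ ← restrict S w<n copy =
    <⇒≱ b<2n (Fin.injective⇒≤ {f = g} g-injective)

-- Monochromatic copies in the layered colouring as perfect matchings of level 0.

injective⇒surjective : ∀ {M} {g : Fin M → Fin M} → Injective _≡_ _≡_ g → ∀ x → ∃ λ z → g z ≡ x
-- If x were missed, adjoining it as a value would inject M + 1 points into M.
injective⇒surjective {M} {g} injective x = decidable-stable (Fin.any? λ z → g z Fin.≟ x) λ missed →
  1+n≰n (Fin.injective⇒≤ {f = extended} (λ {y} {z} → extended-injective missed y z))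
  where
  extended : Fin (suc M) → Fin M
  extended zero    = x
  extended (suc z) = g z
  extended-injective : ¬ (∃ λ z → g z ≡ x) → ∀ y z → extended y ≡ extended z → y ≡ z
  extended-injective missed zero    zero    _  = refl
  extended-injective missed zero    (suc z) eq = contradiction (z , sym eq) missed
  extended-injective missed (suc y) zero    eq = contradiction (y , eq) missed
  extended-injective missed (suc y) (suc z) eq = cong suc (injective eq)

-- The law is an irrelevant field; decidability of the edge relation recovers a usable proof.
Edge-sym : ∀ {N} (S : Subgraph N) {i j} → Edge S i j → Edge S j i
Edge-sym S@record { symm = sy } {i} {j} ij = recompute (Edge? S j i) (sy i j ij)

Edge-incident : ∀ {N} (S : Subgraph N) {i j} → Edge S i j → i ∈ vertices S
Edge-incident S@record { incident = inc } {i} {j} ij = recompute (i ∈? vertices S) (inc i j ij)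

subset-ext : ∀ {n} {p q : Subset n} → (∀ i → i ∈ p ⇔ i ∈ q) → p ≡ q
subset-ext p⇔q = ⊆-antisym (λ {i} → to (p⇔q i)) (λ {i} → from (p⇔q i))

Subgraph-ext : ∀ {N} {S T : Subgraph N} → (∀ i → i ∈ vertices S ⇔ i ∈ vertices T) →
  (∀ i j → Edge S i j ⇔ Edge T i j) → S ≡ T
Subgraph-ext {S = S} {T} V E = Subgraph-≡ (subset-ext V) (trans (sym (tabulate∘lookup _))
  (trans (tabulate-cong λ i → subset-ext (E i)) (tabulate∘lookup _)))

module _ (l w n : ℕ) (w<n : w < n) where
  open Layered (n * 2) l w

  -- Relates a copy to the involution of level 0 that describes it; `length-≤` counts copies through
  -- this relation.
  IsPairing : Subgraph (n * 2 + l * w) → (Fin (n * 2) → Fin (n * 2)) → Set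
  IsPairing S ρ = (∀ i → i ∈ vertices S ⇔ ∃ λ x → base x ≡ i)
                × (∀ i j → Edge S i j ⇔ ∃ λ x → base x ≡ i × base (ρ x) ≡ j)

  IsPairing-unique : ∀ {S T ρ} → IsPairing S ρ → IsPairing T ρ → S ≡ T
  IsPairing-unique (VS , ES) (VT , ET) = Subgraph-ext
    (λ i → mk⇔ (from (VT i) ∘ to (VS i)) (from (VS i) ∘ to (VT i)))
    (λ i j → mk⇔ (from (ET i j) ∘ to (ES i j)) (from (ES i j) ∘ to (ET i j)))

  -- The copy restricts to an injection `g` of 2n vertices into the 2n vertices of level 0, hence a
  -- bijection. Conjugating `mate` by `g` gives a fixed-point-free involution, which the enumeration
  -- contains up to pointwise equality.
  copy⇒pairing : ∀ S → MonochromaticCopy layered (n K₂) S →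
    ∃ λ e → e List.∈ pairings n (allFin (n * 2)) × IsPairing S e
  copy⇒pairing S copy@((h , injective , onto , adj) , _)
    with g , g-injective , base-g ← restrict S w<n copy
    = proj₁ found , proj₁ (proj₂ found) , spans , edges
    where
    g⁻¹ : Fin (n * 2) → Fin (n * 2)
    g⁻¹ x = proj₁ (injective⇒surjective g-injective x)
    g-g⁻¹ : ∀ x → g (g⁻¹ x) ≡ x
    g-g⁻¹ x = proj₂ (injective⇒surjective g-injective x)
    ρ : Fin (n * 2) → Fin (n * 2)
    ρ x = g (mate {n} (g⁻¹ x))
    ρ-g : ∀ z → ρ (g z) ≡ g (mate {n} z)
    ρ-g z = cong (g ∘ mate {n}) (g-injective (g-g⁻¹ (g z)))
    ρ-involutive : ∀ x → ρ (ρ x) ≡ x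
    ρ-involutive x = trans (ρ-g _) (trans (cong g (mate-involutive {n} _)) (g-g⁻¹ x))
    ρ-free : ∀ x → ρ x ≢ x
    ρ-free x ρx≡x = proj₁ (Adj-mate {n} (g⁻¹ x)) (g-injective (trans (g-g⁻¹ x) (sym ρx≡x)))
    found : ∃ λ e → e List.∈ pairings n (allFin (n * 2)) × (∀ {x} → x List.∈ allFin (n * 2) → ρ x ≡ e x)
    found = pairings-complete ρ ρ-involutive ρ-free n (allFin (n * 2))
      (List.length-tabulate id) (allFin⁺ (n * 2)) λ _ → ∈-allFin _
    ρ≗e : ∀ x → ρ x ≡ proj₁ found x
    ρ≗e x = proj₂ (proj₂ found) (∈-allFin x)
    spans : ∀ i → i ∈ vertices S ⇔ ∃ λ x → base x ≡ i
    spans i = mk⇔ (λ i∈S → let z , hz = to (onto i) i∈S in g z , trans (base-g z) hz)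
                  (λ (x , bx) → from (onto i) (g⁻¹ x , trans (sym (base-g _)) (trans (cong base (g-g⁻¹ x)) bx)))
    edges : ∀ i j → Edge S i j ⇔ ∃ λ x → base x ≡ i × base (proj₁ found x) ≡ j
    edges i j = mk⇔ forward backward
      where
      forward : Edge S i j → ∃ λ x → base x ≡ i × base (proj₁ found x) ≡ j
      forward ij with to (onto i) (Edge-incident S ij) | to (onto j) (Edge-incident S (Edge-sym S ij))
      ... | y , refl | z , refl = g y , base-g y ,
        trans (cong base (trans (sym (ρ≗e (g y))) (ρ-g y)))
              (trans (base-g _) (cong h (sym (Adj⇒mate {n} (from (adj y z) ij)))))
      backward : (∃ λ x → base x ≡ i × base (proj₁ found x) ≡ j) → Edge S i j
      backward (x , refl , refl) = subst₂ (Edge S) (trans (sym (base-g _)) (cong base (g-g⁻¹ x)))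
        (trans (sym (base-g _)) (cong base (ρ≗e x))) (to (adj _ _) (Adj-mate {n} (g⁻¹ x)))

  few-copies : ∀ {t} → HasCardinality (MonochromaticCopy layered (n K₂)) t → t ≤ (2 * n ∸ 1) !!
  few-copies (xs , unique , x⇔ , refl) = ≤-trans
    (length-≤ IsPairing unique (λ {S} S∈xs → copy⇒pairing S (to (x⇔ S) S∈xs)) IsPairing-unique)
    (≤-reflexive (length-pairings n (allFin (n * 2)) (List.length-tabulate id)))

  layered-count : ∀ {t} → CopyCount layered (K 3) (n K₂) t → t ≤ (2 * n ∸ 1) !!
  layered-count (r , s , ([] , _ , _ , refl) , hs , refl) = few-copies hs
  layered-count (r , s , (S ∷ _ , _ , x⇔ , _) , hs , refl) =
    contradiction (to (x⇔ S) (here refl)) (no-rainbow-triangle S)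

-- The Gallai-Ramsey number and the bound on the multiplicity.

n≤nC2 : ∀ n → 3 ≤ n → n ≤ n C 2
n≤nC2 (suc zero)       (s≤s ())
n≤nC2 (suc (suc zero)) (s≤s (s≤s ()))
n≤nC2 (suc (suc (suc zero))) _ = ≤-refl
n≤nC2 (suc n@(suc (suc (suc _)))) _ = begin
  suc n            ≤⟨ +-mono-≤ {1} {n} (s≤s z≤n) ≤-refl ⟩
  n + n            ≤⟨ +-mono-≤ (≤-reflexive (sym (nC1≡n n))) (n≤nC2 n (s≤s (s≤s (s≤s z≤n)))) ⟩
  n C 1 + n C 2    ≡⟨ nCk+nC[k+1]≡[n+1]C[k+1] n 1 ⟩
  suc n C 2        ∎
  where open ≤-Reasoning

-- There are finitely many subgraphs, so existence of a copy is decidable and the double negation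
-- can be removed.
unavoidable : ∀ {k N} n → suc (n + k * n) < N → (c : Colouring k N) → ∃ (MonochromaticCopy c (suc n K₂))
unavoidable n large c = decidable-stable (search finite-Subgraph (monochromaticCopy? c (suc n K₂))) λ none →
  Stripes.monochromatic-matching (colour c) (Colouring.symm c) n large λ (_ , _ , mf , n<size) →
  none (matching⇒copy c mf n<size)

-- With k = l + 1 and n = w + 1 the stated order is (k + 1)(n - 1) + 2.
gallaiRamseyNumber : ∀ l w → 1 ≤ w → IsGallaiRamseyNumber (suc l) (K 3) (suc w K₂) (suc w * 2 + l * w)
gallaiRamseyNumber l w 1≤w = (enough-pairs , λ N m≤N c _ → inj₂ (unavoidable w (≤-trans large m≤N) c)) , smallest
  where
  enough-pairs : suc l ≤ (suc w * 2 + l * w) C 2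
  enough-pairs = ≤-trans (+-mono-≤ {1} {suc w * 2} (s≤s z≤n) (subst (_≤ l * w) (*-identityʳ l) (*-monoʳ-≤ l 1≤w)))
    (n≤nC2 _ (≤-trans (s≤s (s≤s (≤-trans 1≤w (m≤m*n w 2)))) (m≤m+n (suc w * 2) (l * w))))
  large : suc (w + (w + l * w)) < suc w * 2 + l * w
  -- The order exceeds the bound 1 + w + kw by exactly one.
  large = ≤-reflexive (cong (λ t → suc (suc t)) (trans (sym (+-assoc w w (l * w)))
    (cong (_+ l * w) (trans (cong (w +_) (sym (+-identityʳ w))) (*-comm 2 w)))))
  smallest : ∀ m → _ → suc w * 2 + l * w ≤ m
  -- A smaller m would also force copies at one vertex below the stated order, where level 0 with 2n
  -- - 1 vertices allows none.
  smallest m (_ , forced) = ≮⇒≥ λ m<gr →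
    [ (λ (S , copy) → no-rainbow-triangle S copy)
    , (λ (S , copy) → no-monochromatic-copy {suc w} ≤-refl ≤-refl S copy) ]′
      (forced (suc (w * 2) + l * w) (≤-pred m<gr) layered (layered-exact (s≤s (≤-trans 1≤w (m≤m*n w 2))) 1≤w))
    where open Layered (suc (w * 2)) l w

theorem3p10 : (k n : ℕ) → k ≥ 6 → n ≥ 2 →
    ∃ λ g → IsGallaiRamseyMultiplicity k (K 3) (n K₂) g × g ≤ (2 * n ∸ 1) !!
theorem3p10 (suc l) (suc w) _ (s≤s 1≤w)
  with t , count ← copyCount (K 3) (suc w K₂) (Layered.layered (suc w * 2) l w)
  with exact ← Layered.layered-exact (suc w * 2) l w (s≤s (s≤s z≤n)) 1≤w
  -- The layered colouring shows that some count is attained, so the least one exists and is at most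
  -- that count.
  with g , isMin ← minimum (exactCount? (K 3) (suc w K₂)) (Layered.layered (suc w * 2) l w , exact , count)
  = g , (suc w * 2 + l * w , gallaiRamseyNumber l w 1≤w , isMin)
  , ≤-trans (proj₂ isMin t (Layered.layered (suc w * 2) l w , exact , count)) (layered-count l w (suc w) ≤-refl count)
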